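{- Let $n,s$ be positive integers such that $n\ge 100s$. Let $H$ be a $3$-graph with vertex set $[n]$. If for every $v\in V(H)$, \[ \rho(N_H(v))>\frac{1}{2}\Big(s-1+\sqrt{(s-1)^2+4s(n-s-1)}\Big), \] then $H$ has a matching of size $s+1$.
   Context: $[n]=\{1,\dots,n\}$. A $3$-graph $H$ is a $3$-uniform hypergraph: a vertex set $V(H)$ together with an edge set $E(H)\subseteq\binom{V(H)}{3}$, the family of $3$-element subsets of $V(H)$. For $v\in V(H)$, the link graph $N_H(v)$ is the simple graph with vertex set $V(H)\setminus\{v\}$ and edge set $\{e\subseteq V(H)\setminus\{v\}: e\cup\{v\}\in E(H)\}$ (its edges are $2$-sets). For a simple graph $G$, $\rho(G)$ denotes its spectral radius, i.e. the largest eigenvalue of its adjacency matrix. A matching in $H$ is a collection of pairwise disjoint edges of $H$; its size is the number of edges in it. -}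

module Defs where

open import Data.Bool using (Bool; T; if_then_else_)
open import Data.Fin using (Fin)
open import Data.Fin.Subset using (Subset; inside; outside; ∣_∣; ⁅_⁆; _∪_; _∩_; Empty)
open import Data.Integer as ℤ using (+_; +[1+_])
import Data.Integer.Properties as ℤₚ
open import Data.List using (List)
open import Data.List.Relation.Unary.All using (All)
open import Data.List.Relation.Unary.AllPairs using (AllPairs)
open import Data.Nat as ℕ using (ℕ; zero; suc; pred)
import Data.Nat.Properties as ℕₚ
import Data.Nat.Solver as ℕ-Solver
open import Data.Product using (∃; Σ; _×_; _,_; proj₁; proj₂)
open import Data.Rational
  using (ℚ; 0ℚ; 1ℚ; ½; mkℚ; _/_; 1/_; _+_; _*_; _-_; -_; _<_; _≤_; Positive; positive; toℚᵘ; *<*)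
  renaming (∣_∣ to ∣_∣ℚ)
import Data.Rational.Properties as ℚₚ
open import Data.Rational.Solver using (module +-*-Solver)
open import Data.Rational.Unnormalised as ℚᵘ using (mkℚᵘ; *≡*)
import Data.Rational.Unnormalised.Properties as ℚᵘₚ
open import Data.Sum using (inj₁; inj₂)
open import Data.Vec using (_∷_; insertAt)
open import Data.Vec.Functional using (Vector; foldr)
open import Relation.Nullary using (¬_; yes; no)
open import Relation.Nullary.Decidable using (⌊_⌋)
open import Relation.Binary.PropositionalEquality
  using (_≡_; refl; sym; trans; cong; subst; subst₂)

-- ℝ is the setoid of Cauchy sequences of rationals; the ∃ makes the modulus data.

IsCauchy : (ℕ → ℚ) → Set
IsCauchy x = ∀ ε → 0ℚ < ε →
  ∃ λ N → ∀ m n → N ℕ.≤ m → N ℕ.≤ n → ∣ x m - x n ∣ℚ < ε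

record ℝ : Set where
  constructor mkℝ
  field
    seq    : ℕ → ℚ
    cauchy : IsCauchy seq

open ℝ public

infix  4 _≈ℝ_ _<ℝ_ _≤ℝ_
infixl 6 _+ℝ_
infixl 7 _*ℝ_

-- Equality of reals is this relation, not propositional equality of sequences.
_≈ℝ_ : ℝ → ℝ → Set
x ≈ℝ y = ∀ ε → 0ℚ < ε → ∃ λ N → ∀ n → N ℕ.≤ n → ∣ seq x n - seq y n ∣ℚ < ε

_<ℝ_ : ℝ → ℝ → Set
x <ℝ y = ∃ λ ε → 0ℚ < ε × ∃ λ N → ∀ n → N ℕ.≤ n → seq x n + ε < seq y n

_≤ℝ_ : ℝ → ℝ → Set
x ≤ℝ y = ¬ (y <ℝ x)

private
  ½*-pos : ∀ {ε} → 0ℚ < ε → 0ℚ < ½ * ε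
  ½*-pos {ε} 0<ε = subst (_< ½ * ε) (ℚₚ.*-zeroʳ ½) (ℚₚ.*-monoʳ-<-pos ½ 0<ε)

  halves : ∀ ε → ½ * ε + ½ * ε ≡ ε
  halves ε = trans (sym (ℚₚ.*-distribʳ-+ ε ½ ½)) (ℚₚ.*-identityˡ ε)

  ∣∣-< : ∀ {p ε} → p < ε → - p < ε → ∣ p ∣ℚ < ε
  ∣∣-< {p} {ε} p<ε -p<ε with ℚₚ.∣p∣≡p∨∣p∣≡-p p
  ... | inj₁ eq = subst (_< ε) (sym eq) p<ε
  ... | inj₂ eq = subst (_< ε) (sym eq) -p<ε

  const-cauchy : ∀ q → IsCauchy (λ _ → q)
  const-cauchy q ε 0<ε = 0 , λ _ _ _ _ →
    subst (_< ε) (sym (cong ∣_∣ℚ (ℚₚ.+-inverseʳ q))) 0<ε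

  +-cauchy : ∀ x y → IsCauchy x → IsCauchy y → IsCauchy (λ n → x n + y n)
  +-cauchy x y cx cy ε 0<ε = M ℕ.+ N , λ m n p q → begin-strict
      ∣ (x m + y m) - (x n + y n) ∣ℚ
        ≡⟨ cong ∣_∣ℚ (rearrange (x m) (y m) (x n) (y n)) ⟩
      ∣ (x m - x n) + (y m - y n) ∣ℚ
        ≤⟨ ℚₚ.∣p+q∣≤∣p∣+∣q∣ (x m - x n) (y m - y n) ⟩
      ∣ x m - x n ∣ℚ + ∣ y m - y n ∣ℚ
        <⟨ ℚₚ.+-mono-< (proj₂ hx m n (M≤ p) (M≤ q)) (proj₂ hy m n (N≤ p) (N≤ q)) ⟩
      ½ * ε + ½ * ε
        ≡⟨ halves ε ⟩
      ε ∎
    where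
    open ℚₚ.≤-Reasoning
    hx = cx (½ * ε) (½*-pos 0<ε)
    hy = cy (½ * ε) (½*-pos 0<ε)
    M = proj₁ hx
    N = proj₁ hy
    M≤ : ∀ {m} → M ℕ.+ N ℕ.≤ m → M ℕ.≤ m
    M≤ = ℕₚ.≤-trans (ℕₚ.m≤m+n M N)
    N≤ : ∀ {m} → M ℕ.+ N ℕ.≤ m → N ℕ.≤ m
    N≤ = ℕₚ.≤-trans (ℕₚ.m≤n+m N M)
    rearrange : ∀ a b c d → (a + b) - (c + d) ≡ (a - c) + (b - d)
    rearrange = solve 4 (λ a b c d → (a :+ b) :- (c :+ d) := (a :- c) :+ (b :- d)) refl
      where open +-*-Solver

  bounded : ∀ x → IsCauchy x →
            ∃ λ B → Positive B × ∃ λ N → ∀ n → N ℕ.≤ n → ∣ x n ∣ℚ ≤ B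
  bounded x cx = B , posB , N , λ n N≤n → begin
      ∣ x n ∣ℚ                      ≡⟨ cong ∣_∣ℚ (split (x n) (x N)) ⟩
      ∣ (x n - x N) + x N ∣ℚ        ≤⟨ ℚₚ.∣p+q∣≤∣p∣+∣q∣ (x n - x N) (x N) ⟩
      ∣ x n - x N ∣ℚ + ∣ x N ∣ℚ     ≤⟨ ℚₚ.+-monoˡ-≤ ∣ x N ∣ℚ
                                        (ℚₚ.<⇒≤ (proj₂ h n N N≤n ℕₚ.≤-refl)) ⟩
      1ℚ + ∣ x N ∣ℚ                 ∎
    where
    open ℚₚ.≤-Reasoning
    h = cx 1ℚ (ℚₚ.positive⁻¹ 1ℚ)
    N = proj₁ h
    B = 1ℚ + ∣ x N ∣ℚ
    posB = ℚₚ.pos+nonNeg⇒pos 1ℚ ∣ x N ∣ℚ {{ℚₚ.∣-∣-nonNeg (x N)}}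
    split : ∀ a b → a ≡ (a - b) + b
    split = solve 2 (λ a b → a := (a :- b) :+ b) refl
      where open +-*-Solver

  divide : ∀ B → Positive B → ∀ {ε} → 0ℚ < ε → ∃ λ δ → 0ℚ < δ × B * δ ≡ ε
  divide B posB {ε} 0<ε = C * ε , 0<δ , eq
    where
    instance
      _ = posB
      _ = ℚₚ.pos⇒nonZero B
    C = 1/ B
    0<δ : 0ℚ < C * ε
    0<δ = subst (_< C * ε) (ℚₚ.*-zeroʳ C) (ℚₚ.*-monoʳ-<-pos C {{ℚₚ.1/pos⇒pos B}} 0<ε)
    eq : B * (C * ε) ≡ ε
    eq = trans (sym (ℚₚ.*-assoc B C ε))
           (trans (cong (_* ε) (ℚₚ.*-inverseʳ B)) (ℚₚ.*-identityˡ ε))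

  ∣*∣-< : ∀ a b {D δ ε} → Positive D → ∣ a ∣ℚ ≤ D → ∣ b ∣ℚ < δ → D * δ ≡ ε → ∣ a * b ∣ℚ < ε
  ∣*∣-< a b {D} {δ} {ε} posD a≤D b<δ eq = begin-strict
      ∣ a * b ∣ℚ        ≡⟨ ℚₚ.∣p*q∣≡∣p∣*∣q∣ a b ⟩
      ∣ a ∣ℚ * ∣ b ∣ℚ   ≤⟨ ℚₚ.*-monoʳ-≤-nonNeg ∣ b ∣ℚ {{ℚₚ.∣-∣-nonNeg b}} a≤D ⟩
      D * ∣ b ∣ℚ        <⟨ ℚₚ.*-monoʳ-<-pos D {{posD}} b<δ ⟩
      D * δ             ≡⟨ eq ⟩
      ε                 ∎
    where open ℚₚ.≤-Reasoning

  ∣*-*∣-< : ∀ a b c d {B C δ η ε} → Positive B → Positive C →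
            ∣ a ∣ℚ ≤ B → ∣ d ∣ℚ ≤ C → ∣ b - d ∣ℚ < δ → ∣ a - c ∣ℚ < η →
            B * δ ≡ ½ * ε → C * η ≡ ½ * ε → ∣ a * b - c * d ∣ℚ < ε
  ∣*-*∣-< a b c d {B} {C} {δ} {η} {ε} posB posC a≤B d≤C b-d a-c Bδ Cη = begin-strict
      ∣ a * b - c * d ∣ℚ
        ≡⟨ cong ∣_∣ℚ (rearrange a b c d) ⟩
      ∣ a * (b - d) + d * (a - c) ∣ℚ
        ≤⟨ ℚₚ.∣p+q∣≤∣p∣+∣q∣ (a * (b - d)) (d * (a - c)) ⟩
      ∣ a * (b - d) ∣ℚ + ∣ d * (a - c) ∣ℚ
        <⟨ ℚₚ.+-mono-< (∣*∣-< a (b - d) posB a≤B b-d Bδ) (∣*∣-< d (a - c) posC d≤C a-c Cη) ⟩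
      ½ * ε + ½ * ε
        ≡⟨ halves ε ⟩
      ε ∎
    where
    open ℚₚ.≤-Reasoning
    rearrange : ∀ a b c d → a * b - c * d ≡ a * (b - d) + d * (a - c)
    rearrange = solve 4 (λ a b c d →
        (a :* b) :- (c :* d) := (a :* (b :- d)) :+ (d :* (a :- c))) refl
      where open +-*-Solver

  *-cauchy : ∀ x y → IsCauchy x → IsCauchy y → IsCauchy (λ n → x n * y n)
  *-cauchy x y cx cy ε 0<ε =
    let B , posB , N₁ , bx = bounded x cx
        C , posC , N₂ , by = bounded y cy
        δ , 0<δ , Bδ = divide B posB (½*-pos 0<ε)
        η , 0<η , Cη = divide C posC (½*-pos 0<ε)
        N₃ , hy = cy δ 0<δ
        N₄ , hx = cx η 0<η
        N₁₂ = N₁ ℕ.⊔ N₂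
        N₃₄ = N₃ ℕ.⊔ N₄
    in N₁₂ ℕ.⊔ N₃₄ , λ m n p q →
      let m₁₂ = ℕₚ.m⊔n≤o⇒m≤o N₁₂ N₃₄ p
          m₃₄ = ℕₚ.m⊔n≤o⇒n≤o N₁₂ N₃₄ p
          n₁₂ = ℕₚ.m⊔n≤o⇒m≤o N₁₂ N₃₄ q
          n₃₄ = ℕₚ.m⊔n≤o⇒n≤o N₁₂ N₃₄ q
      in ∣*-*∣-< (x m) (y m) (x n) (y n) posB posC
           (bx m (ℕₚ.m⊔n≤o⇒m≤o N₁ N₂ m₁₂))
           (by n (ℕₚ.m⊔n≤o⇒n≤o N₁ N₂ n₁₂))
           (hy m n (ℕₚ.m⊔n≤o⇒m≤o N₃ N₄ m₃₄) (ℕₚ.m⊔n≤o⇒m≤o N₃ N₄ n₃₄))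
           (hx m n (ℕₚ.m⊔n≤o⇒n≤o N₃ N₄ m₃₄) (ℕₚ.m⊔n≤o⇒n≤o N₃ N₄ n₃₄))
           Bδ Cη

fromℚ : ℚ → ℝ
fromℚ q = mkℝ (λ _ → q) (const-cauchy q)

fromℕ : ℕ → ℝ
fromℕ n = fromℚ (+ n / 1)

0ℝ 1ℝ : ℝ
0ℝ = fromℚ 0ℚ
1ℝ = fromℚ 1ℚ

_+ℝ_ : ℝ → ℝ → ℝ
mkℝ x cx +ℝ mkℝ y cy = mkℝ (λ n → x n + y n) (+-cauchy x y cx cy)

_*ℝ_ : ℝ → ℝ → ℝ
mkℝ x cx *ℝ mkℝ y cy = mkℝ (λ n → x n * y n) (*-cauchy x y cx cy)

⌊√_⌋ : ℕ → ℕ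
⌊√ zero ⌋  = 0
⌊√ suc n ⌋ = let r = ⌊√ n ⌋ in
  if ⌊ suc r ℕ.* suc r ℕ.≤? suc n ⌋ then suc r else r

⌊√⌋-lower : ∀ n → ⌊√ n ⌋ ℕ.* ⌊√ n ⌋ ℕ.≤ n
⌊√⌋-lower zero = ℕ.z≤n
⌊√⌋-lower (suc n) with suc ⌊√ n ⌋ ℕ.* suc ⌊√ n ⌋ ℕ.≤? suc n
... | yes p = p
... | no  _ = ℕₚ.m≤n⇒m≤1+n (⌊√⌋-lower n)

⌊√⌋-upper : ∀ n → n ℕ.< suc ⌊√ n ⌋ ℕ.* suc ⌊√ n ⌋
⌊√⌋-upper zero = ℕ.s≤s ℕ.z≤n
⌊√⌋-upper (suc n) with suc ⌊√ n ⌋ ℕ.* suc ⌊√ n ⌋ ℕ.≤? suc n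
... | yes _ = ℕₚ.≤-<-trans (⌊√⌋-upper n)
                (ℕₚ.*-mono-< (ℕₚ.n<1+n (suc ⌊√ n ⌋)) (ℕₚ.n<1+n (suc ⌊√ n ⌋)))
... | no ¬p = ℕₚ.≰⇒> ¬p

-- ⌊p√N⌋ / p with p = k + 1, which is within 1 / p of √N.
√-approx : ℕ → ℕ → ℚ
√-approx N k = + ⌊√ N ℕ.* (suc k ℕ.* suc k) ⌋ / suc k

private
  /-mono : ∀ a b p q → a ℕ.* suc q ℕ.< b ℕ.* suc p → + a / suc p < + b / suc q
  /-mono a b p q h = ℚₚ.toℚᵘ-cancel-<
    (ℚᵘₚ.<-respˡ-≃ (ℚᵘₚ.≃-sym (ℚₚ.toℚᵘ-fromℚᵘ (mkℚᵘ (+ a) p)))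
    (ℚᵘₚ.<-respʳ-≃ (ℚᵘₚ.≃-sym (ℚₚ.toℚᵘ-fromℚᵘ (mkℚᵘ (+ b) q)))
      (ℚᵘ.*<* (subst₂ ℤ._<_ (ℤₚ.pos-* a (suc q)) (ℤₚ.pos-* b (suc p)) (ℤ.+<+ h)))))

  /-suc : ∀ b q → + suc b / suc q ≡ + 1 / suc q + + b / suc q
  /-suc b q = ℚₚ.toℚᵘ-injective (begin-equality
      toℚᵘ (+ suc b / suc q)
        ≃⟨ ℚₚ.toℚᵘ-fromℚᵘ (mkℚᵘ (+ suc b) q) ⟩
      mkℚᵘ (+ suc b) q
        ≃⟨ *≡* eq ⟩
      mkℚᵘ (+ 1) q ℚᵘ.+ mkℚᵘ (+ b) q
        ≃⟨ ℚᵘₚ.+-cong (ℚₚ.toℚᵘ-fromℚᵘ (mkℚᵘ (+ 1) q)) (ℚₚ.toℚᵘ-fromℚᵘ (mkℚᵘ (+ b) q)) ⟨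
      toℚᵘ (+ 1 / suc q) ℚᵘ.+ toℚᵘ (+ b / suc q)
        ≃⟨ ℚₚ.toℚᵘ-homo-+ (+ 1 / suc q) (+ b / suc q) ⟨
      toℚᵘ (+ 1 / suc q + + b / suc q) ∎)
    where
    open ℚᵘₚ.≤-Reasoning
    Q = + suc q
    eq : (+ suc b) ℤ.* (Q ℤ.* Q) ≡ ((+ 1) ℤ.* Q ℤ.+ (+ b) ℤ.* Q) ℤ.* Q
    eq = trans (sym (ℤₚ.*-assoc (+ suc b) Q Q))
               (cong (ℤ._* Q) (ℤₚ.*-distribʳ-+ Q (+ 1) (+ b)))

  cross : ∀ N p q →
    ⌊√ N ℕ.* (suc p ℕ.* suc p) ⌋ ℕ.* suc q ℕ.< suc ⌊√ N ℕ.* (suc q ℕ.* suc q) ⌋ ℕ.* suc p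
  cross N p q = ℕₚ.≰⇒> λ h → ℕₚ.<⇒≱ squares (ℕₚ.*-mono-≤ h h)
    where
    open ℕₚ.≤-Reasoning
    open ℕ-Solver.+-*-Solver
    P = suc p ℕ.* suc p
    Q = suc q ℕ.* suc q
    a = ⌊√ N ℕ.* P ⌋
    b = ⌊√ N ℕ.* Q ⌋
    square : ∀ u v → (u ℕ.* v) ℕ.* (u ℕ.* v) ≡ (u ℕ.* u) ℕ.* (v ℕ.* v)
    square = solve 2 (λ u v → (u :* v) :* (u :* v) := (u :* u) :* (v :* v)) refl
    swap : ∀ N u v → (N ℕ.* u) ℕ.* v ≡ (N ℕ.* v) ℕ.* u
    swap = solve 3 (λ N u v → (N :* u) :* v := (N :* v) :* u) refl
    squares : (a ℕ.* suc q) ℕ.* (a ℕ.* suc q) ℕ.< (suc b ℕ.* suc p) ℕ.* (suc b ℕ.* suc p)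
    squares = begin-strict
      (a ℕ.* suc q) ℕ.* (a ℕ.* suc q)          ≡⟨ square a (suc q) ⟩
      (a ℕ.* a) ℕ.* Q                          ≤⟨ ℕₚ.*-monoˡ-≤ Q (⌊√⌋-lower (N ℕ.* P)) ⟩
      (N ℕ.* P) ℕ.* Q                          ≡⟨ swap N P Q ⟩
      (N ℕ.* Q) ℕ.* P                          <⟨ ℕₚ.*-monoˡ-< P (⌊√⌋-upper (N ℕ.* Q)) ⟩
      (suc b ℕ.* suc b) ℕ.* P                  ≡⟨ square (suc b) (suc p) ⟨
      (suc b ℕ.* suc p) ℕ.* (suc b ℕ.* suc p)  ∎

  √-step : ∀ N p q → √-approx N p - √-approx N q < + 1 / suc q
  √-step N p q = begin-strict
      x - y              <⟨ ℚₚ.+-monoˡ-< (- y) (/-mono a (suc b) p q (cross N p q)) ⟩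
      + suc b / suc q - y  ≡⟨ cong (_- y) (/-suc b q) ⟩
      (u + y) - y        ≡⟨ ℚₚ.+-assoc u y (- y) ⟩
      u + (y - y)        ≡⟨ cong (λ z → u + z) (ℚₚ.+-inverseʳ y) ⟩
      u + 0ℚ             ≡⟨ ℚₚ.+-identityʳ u ⟩
      u                  ∎
    where
    open ℚₚ.≤-Reasoning
    x = √-approx N p
    y = √-approx N q
    u = + 1 / suc q
    a = ⌊√ N ℕ.* (suc p ℕ.* suc p) ⌋
    b = ⌊√ N ℕ.* (suc q ℕ.* suc q) ⌋

  1/-small : ∀ ε → 0ℚ < ε → ∃ λ K → ∀ n → K ℕ.≤ n → + 1 / suc n < ε
  1/-small (mkℚ (+ 0) d c) (*<* (ℤ.+<+ ()))
  1/-small ε@(mkℚ +[1+ k ] d c) _ = suc d , λ n K≤n →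
    subst (+ 1 / suc n <_) (ℚₚ.fromℚᵘ-toℚᵘ ε)
      (/-mono 1 (suc k) n d (ℕₚ.<-≤-trans
        (subst (ℕ._< suc n) (sym (ℕₚ.*-identityˡ (suc d))) (ℕ.s≤s K≤n))
        (ℕₚ.m≤m+n (suc n) (k ℕ.* suc n))))
  1/-small (mkℚ ℤ.-[1+ k ] d c) (*<* ())

  √-cauchy : ∀ N → IsCauchy (√-approx N)
  √-cauchy N ε 0<ε with 1/-small ε 0<ε
  ... | K , small = K , λ m n K≤m K≤n → ∣∣-<
    (ℚₚ.<-trans (√-step N m n) (small n K≤n))
    (subst (_< ε) (negate (√-approx N n) (√-approx N m))
      (ℚₚ.<-trans (√-step N n m) (small m K≤m)))
    where
    negate : ∀ a b → a - b ≡ - (b - a)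
    negate = solve 2 (λ a b → a :- b := :- (b :- a)) refl
      where open +-*-Solver

infix 8 √_

√_ : ℕ → ℝ
√ N = mkℝ (√-approx N) (√-cauchy N)

Matrix : ℕ → Set
Matrix n = Fin n → Fin n → ℝ

_*ᵥ_ : ∀ {n} → Matrix n → Vector ℝ n → Vector ℝ n
(A *ᵥ x) i = foldr _+ℝ_ 0ℝ (λ j → A i j *ℝ x j)

IsEigenvalue : ∀ {n} → Matrix n → ℝ → Set
IsEigenvalue {n} A μ = Σ (Vector ℝ n) λ x →
  ¬ (∀ i → x i ≈ℝ 0ℝ) × (∀ i → (A *ᵥ x) i ≈ℝ μ *ℝ x i)

IsLargestEigenvalue : ∀ {n} → Matrix n → ℝ → Set
IsLargestEigenvalue A ρ = IsEigenvalue A ρ × (∀ μ → IsEigenvalue A μ → μ ≤ℝ ρ)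

record UniformHypergraph (k n : ℕ) : Set where
  field
    edge?   : Subset n → Bool
    uniform : ∀ e → T (edge? e) → ∣ e ∣ ≡ k

  IsEdge : Subset n → Set
  IsEdge e = T (edge? e)

open UniformHypergraph public

SimpleGraph ThreeGraph : ℕ → Set
SimpleGraph = UniformHypergraph 2
ThreeGraph  = UniformHypergraph 3

private
  ∣insertAt∣ : ∀ {n} (e : Subset n) v → ∣ insertAt e v inside ∣ ≡ suc ∣ e ∣
  ∣insertAt∣ e             Fin.zero    = refl
  ∣insertAt∣ (inside  ∷ e) (Fin.suc v) = cong suc (∣insertAt∣ e v)
  ∣insertAt∣ (outside ∷ e) (Fin.suc v) = ∣insertAt∣ e v

-- The vertex set of the link is the complement of v, identified with
-- Fin (n - 1) by the order isomorphism punchIn v.  Under this identification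
-- insertAt e v inside is the set e ∪ {v}.
link : ∀ {n} → ThreeGraph n → Fin n → SimpleGraph (pred n)
link {suc n} H v = record
  { edge?   = λ e → edge? H (insertAt e v inside)
  ; uniform = λ e p → ℕₚ.suc-injective
      (trans (sym (∣insertAt∣ e v)) (uniform H (insertAt e v inside) p))
  }

-- For i ≡ j the set below is a singleton, hence not an edge.
adjacency : ∀ {n} → SimpleGraph n → Matrix n
adjacency G i j = if edge? G (⁅ i ⁆ ∪ ⁅ j ⁆) then 1ℝ else 0ℝ

-- The spectral radius as a relation; ρ is unique up to _≈ℝ_.
IsSpectralRadius : ∀ {n} → SimpleGraph n → ℝ → Set
IsSpectralRadius G ρ = IsLargestEigenvalue (adjacency G) ρ

-- The edges are nonempty, so disjointness makes the listed edges distinct and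
-- the size of the matching is the length of the list.
IsMatching : ∀ {n} → ThreeGraph n → List (Subset n) → Set
IsMatching H M = All (IsEdge H) M × AllPairs (λ e f → Empty (e ∩ f)) M

{-# OPTIONS --safe #-}
-- Call a pair of vertices heavy if its codegree exceeds 3s, and a vertex big if it
-- lies in more than 3s heavy pairs.  A matching avoiding a set of big vertices can be
-- extended greedily by one edge through each of them, as long as its final size is at
-- most s + 1.  So if there is no matching of size s + 1, then the set B of big vertices
-- has size b ≤ s, and a maximal matching of H - B has size at most k = s - b; let W be its
-- vertex set, so |W| ≤ 3k and B ∪ W meets every edge.  The vertices of W lie in at most
-- 9sk heavy pairs altogether, hence, as n ≥ 100s, some v outside B ∪ W is in at most k / 4
-- heavy pairs with W.  In the link of v let C consist of B and of these few partners of v.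
-- Every vertex of W \ C has degree at most 3s there, and the vertices outside C ∪ W have
-- all their neighbours in C ∪ W.  If q = a / p is a rational number between the threshold
-- and the spectral radius, the weights 4q on C, 6s on W \ C and 4b + 3k elsewhere form
-- a vector w > 0 with A w ≤ q w, so q bounds every eigenvalue of A: a contradiction.
module Submission where

open import Defs
open import Algebra.Bundles using (CommutativeRing)
open import Data.Bool using (Bool; true; false; T?; if_then_else_)
open import Data.Fin as Fin using (Fin; punchIn)
open import Data.Fin.Properties using (any?; punchInᵢ≢i)
open import Data.Fin.Subset as Subset using (Subset; inside; outside; ⁅_⁆; _∪_; _∩_; _∈_; _∉_; _⊆_; ∣_∣; ⋃; Empty)
open import Data.Fin.Subset.Properties
open import Data.List using (List; []; _∷_; length)
open import Data.List.Relation.Unary.All using (All; []; _∷_)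
open import Data.List.Relation.Unary.AllPairs using ([]; _∷_)
open import Data.Product using (∃; _×_; _,_; proj₁; proj₂)
open import Data.Rational using (½)
open import Data.Sum using (_⊎_; inj₁; inj₂)
open import Data.Vec using ([]; _∷_; lookup; tabulate; insertAt; here; there)
open import Data.Vec.Properties using (lookup∘tabulate; tabulate-cong; []=⇒lookup; lookup⇒[]=)
open import Function using (_∘_; id)
open import Relation.Nullary using (¬_; Dec; yes; no; does; ¬?; contradiction; _×-dec_)
open import Relation.Nullary.Decidable using (dec-true)
open import Relation.Binary.PropositionalEquality

-- Natural numbers inside ℚ and finite sums of rationals.

module Spectral where

  open import Data.Integer as ℤ using (+_; +[1+_])
  import Data.Integer.Properties as ℤₚ
  open import Data.Nat as ℕ using (ℕ; zero; suc; z≤n; s≤s)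
  import Data.Nat.Properties as ℕₚ
  open import Data.Rational
    using (ℚ; mkℚ; 0ℚ; 1ℚ; _/_; _+_; _*_; _-_; -_; _<_; _≤_; toℚᵘ; nonNegative; positive; *<*)
    renaming (∣_∣ to ∣_∣ℚ)
  import Data.Rational.Properties as ℚₚ
  open import Data.Rational.Solver using (module +-*-Solver)
  open import Data.Rational.Unnormalised as ℚᵘ using (mkℚᵘ; *≡*)
  import Data.Rational.Unnormalised.Properties as ℚᵘₚ
  open import Data.Vec.Functional using (foldr)
  open import Algebra.Properties.Semiring.Sum (CommutativeRing.semiring ℚₚ.+-*-commutativeRing)
    using (sum; ∑-distrib-+; ∑-comm; *-distribˡ-sum; sum-cong-≗)
  import Algebra.Properties.Semiring.Sum ℕₚ.+-*-semiring as ℕ-Sum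

  opaque
    -- Opaque, so that the fraction is never normalised when terms are compared; `ι-def` links it to
    -- `fromℕ` and to the constants 0 and 1.
    ι : ℕ → ℚ
    ι n = + n / 1

    toℚᵘ-ι : ∀ n → toℚᵘ (ι n) ℚᵘ.≃ mkℚᵘ (+ n) 0
    toℚᵘ-ι n = ℚₚ.toℚᵘ-fromℚᵘ (mkℚᵘ (+ n) 0)

    ι-+ : ∀ m n → ι (m ℕ.+ n) ≡ ι m + ι n
    ι-+ m n = ℚₚ.toℚᵘ-injective (begin-equality
      toℚᵘ (ι (m ℕ.+ n))                   ≃⟨ toℚᵘ-ι (m ℕ.+ n) ⟩
      mkℚᵘ (+ (m ℕ.+ n)) 0                 ≃⟨ *≡* (cong (ℤ._* + 1) (sym (cong₂ ℤ._+_ (ℤₚ.*-identityʳ (+ m))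
            (ℤₚ.*-identityʳ (+ n))))) ⟩
      mkℚᵘ (+ m) 0 ℚᵘ.+ mkℚᵘ (+ n) 0       ≃⟨ ℚᵘₚ.+-cong (toℚᵘ-ι m) (toℚᵘ-ι n) ⟨
      toℚᵘ (ι m) ℚᵘ.+ toℚᵘ (ι n)           ≃⟨ ℚₚ.toℚᵘ-homo-+ (ι m) (ι n) ⟨
      toℚᵘ (ι m + ι n)                     ∎)
      where open ℚᵘₚ.≤-Reasoning

    ι-* : ∀ m n → ι (m ℕ.* n) ≡ ι m * ι n
    ι-* m n = ℚₚ.toℚᵘ-injective (begin-equality
      toℚᵘ (ι (m ℕ.* n))                   ≃⟨ toℚᵘ-ι (m ℕ.* n) ⟩
      mkℚᵘ (+ (m ℕ.* n)) 0                 ≃⟨ *≡* (cong (ℤ._* + 1) (ℤₚ.pos-* m n)) ⟩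
      mkℚᵘ (+ m) 0 ℚᵘ.* mkℚᵘ (+ n) 0       ≃⟨ ℚᵘₚ.*-cong (toℚᵘ-ι m) (toℚᵘ-ι n) ⟨
      toℚᵘ (ι m) ℚᵘ.* toℚᵘ (ι n)           ≃⟨ ℚₚ.toℚᵘ-homo-* (ι m) (ι n) ⟨
      toℚᵘ (ι m * ι n)                     ∎)
      where open ℚᵘₚ.≤-Reasoning

    ι-mono : ∀ {m n} → m ℕ.≤ n → ι m ≤ ι n
    ι-mono {m} {n} m≤n = ℚₚ.toℚᵘ-cancel-≤
      (ℚᵘₚ.≤-respˡ-≃ (ℚᵘₚ.≃-sym (toℚᵘ-ι m)) (ℚᵘₚ.≤-respʳ-≃ (ℚᵘₚ.≃-sym (toℚᵘ-ι n))
        (ℚᵘ.*≤* (subst₂ ℤ._≤_ (sym (ℤₚ.*-identityʳ (+ m))) (sym (ℤₚ.*-identityʳ (+ n))) (ℤ.+≤+ m≤n)))))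

    ι*/ : ∀ a n → ι (suc n) * (+ a / suc n) ≡ ι a
    ι*/ a n = ℚₚ.toℚᵘ-injective (begin-equality
      toℚᵘ (ι (suc n) * (+ a / suc n))                ≃⟨ ℚₚ.toℚᵘ-homo-* (ι (suc n)) (+ a / suc n) ⟩
      toℚᵘ (ι (suc n)) ℚᵘ.* toℚᵘ (+ a / suc n)        ≃⟨ ℚᵘₚ.*-cong (toℚᵘ-ι (suc n)) (ℚₚ.toℚᵘ-fromℚᵘ (mkℚᵘ (+ a) n)) ⟩
      mkℚᵘ (+ suc n) 0 ℚᵘ.* mkℚᵘ (+ a) n              ≃⟨ *≡* (trans (ℤₚ.*-identityʳ _) (trans (ℤₚ.*-comm
            (+ suc n) (+ a)) (cong (λ z → + a ℤ.* + z) (sym (ℕₚ.+-identityʳ (suc n)))))) ⟩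
      mkℚᵘ (+ a) 0                                    ≃⟨ toℚᵘ-ι a ⟨
      toℚᵘ (ι a)                                      ∎)
      where open ℚᵘₚ.≤-Reasoning

    ι-def : ∀ n → ι n ≡ + n / 1
    ι-def n = refl

  0≤ι : ∀ n → 0ℚ ≤ ι n
  0≤ι n = subst (_≤ ι n) (ι-def 0) (ι-mono {0} {n} z≤n)

  ι-sum : ∀ {n} (f : Fin n → ℕ) → ι (ℕ-Sum.sum f) ≡ sum (ι ∘ f)
  ι-sum {zero}  f = ι-def 0
  ι-sum {suc n} f = trans (ι-+ (f Fin.zero) _) (cong (λ z → ι (f Fin.zero) + z) (ι-sum (f ∘ Fin.suc)))

  sum-mono : ∀ {n} {f g : Fin n → ℚ} → (∀ i → f i ≤ g i) → sum f ≤ sum g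
  sum-mono {zero}  f≤g = ℚₚ.≤-refl
  sum-mono {suc n} f≤g = ℚₚ.+-mono-≤ (f≤g Fin.zero) (sum-mono (f≤g ∘ Fin.suc))

  sum-nonNeg : ∀ {n} {f : Fin n → ℚ} → (∀ i → 0ℚ ≤ f i) → 0ℚ ≤ sum f
  sum-nonNeg {zero}  0≤f = ℚₚ.≤-refl
  sum-nonNeg {suc n} 0≤f = ℚₚ.+-mono-≤ (0≤f Fin.zero) (sum-nonNeg (0≤f ∘ Fin.suc))

  term≤sum : ∀ {n} {f : Fin n → ℚ} → (∀ i → 0ℚ ≤ f i) → ∀ i → f i ≤ sum f
  term≤sum {suc n} {f} 0≤f Fin.zero = subst (_≤ sum f) (ℚₚ.+-identityʳ _)
    (ℚₚ.+-monoʳ-≤ (f Fin.zero) (sum-nonNeg (0≤f ∘ Fin.suc)))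
  term≤sum {suc n} {f} 0≤f (Fin.suc i) = subst (_≤ sum f) (ℚₚ.+-identityˡ _)
    (ℚₚ.+-mono-≤ (0≤f Fin.zero) (term≤sum (0≤f ∘ Fin.suc) i))

  ∣sum∣≤ : ∀ {n} (f : Fin n → ℚ) → ∣ sum f ∣ℚ ≤ sum (∣_∣ℚ ∘ f)
  ∣sum∣≤ {zero}  f = ℚₚ.≤-refl
  ∣sum∣≤ {suc n} f = ℚₚ.≤-trans (ℚₚ.∣p+q∣≤∣p∣+∣q∣ (f Fin.zero) _)
    (ℚₚ.+-monoʳ-≤ ∣ f Fin.zero ∣ℚ (∣sum∣≤ (f ∘ Fin.suc)))

  p≤∣p∣ : ∀ p → p ≤ ∣ p ∣ℚ
  p≤∣p∣ p with ℚₚ.≤-total 0ℚ p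
  ... | inj₁ 0≤p = ℚₚ.≤-reflexive (sym (ℚₚ.0≤p⇒∣p∣≡p 0≤p))
  ... | inj₂ p≤0 = ℚₚ.≤-trans p≤0 (ℚₚ.0≤∣p∣ p)

  *-nonNeg : ∀ {p q} → 0ℚ ≤ p → 0ℚ ≤ q → 0ℚ ≤ p * q
  *-nonNeg {p} {q} 0≤p 0≤q = ℚₚ.nonNegative⁻¹
        (p * q) {{ℚₚ.nonNeg*nonNeg⇒nonNeg p {{nonNegative 0≤p}} q {{nonNegative 0≤q}}}}

  *-monoˡ : ∀ {r p q} → 0ℚ ≤ r → p ≤ q → r * p ≤ r * q
  *-monoˡ {r} 0≤r = ℚₚ.*-monoˡ-≤-nonNeg r {{nonNegative 0≤r}}

  +-cancelˡ-≤ : ∀ r {p q} → r + p ≤ r + q → p ≤ q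
  +-cancelˡ-≤ r {p} {q} h = subst₂ _≤_ (cancel p) (cancel q) (ℚₚ.+-monoʳ-≤ (- r) h)
    where
    open +-*-Solver
    cancel : ∀ z → - r + (r + z) ≡ z
    cancel = solve 2 (λ r z → :- r :+ (r :+ z) := z) refl r

  -- Pairing with w: A w ≤ (a / p) w and the symmetry of A bound ⟨w , A y⟩ by (a / p) ⟨w , y⟩.
  pairing-bound : ∀ {m} (A : Fin m → Fin m → ℚ) → (∀ i j → A i j ≡ A j i) →
    (w y : Fin m → ℚ) (a p η : ℚ) → (∀ i → 0ℚ ≤ w i) → (∀ i → 0ℚ ≤ y i) →
    (∀ i → p * sum (λ j → A i j * w j) ≤ a * w i) →
    (∀ i → (a + 1ℚ) * y i ≤ p * (sum (λ j → A i j * y j) + η)) →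
    sum (λ i → w i * y i) ≤ p * η * sum w
  pairing-bound A A-sym w y a p η 0≤w 0≤y super approx = +-cancelˡ-≤ (a * S) (begin
    a * S + S                                            ≡⟨ solve 2 (λ a s → a :* s :+ s :=
          (a :+ con 1ℚ) :* s) refl a S ⟩
    (a + 1ℚ) * S                                         ≡⟨ *-distribˡ-sum (a + 1ℚ) (λ i → w i * y i) ⟩
    sum (λ i → (a + 1ℚ) * (w i * y i))                   ≤⟨ sum-mono row ⟩
    sum (λ i → sum (λ j → B i j) + p * η * w i)
                                                         ≡⟨ ∑-distrib-+ (λ i → sum (λ j → B i j))
                                                               (λ i → p * η * w i) ⟩
    sum (λ i → sum (λ j → B i j)) + sum (λ i → p * η * w i)
                                                         ≡⟨ cong₂ _+_ (∑-comm B) (sym (*-distribˡ-sum (p * η) w)) ⟩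
    sum (λ j → sum (λ i → B i j)) + p * η * sum w
                                                         ≤⟨ ℚₚ.+-monoˡ-≤ _ (sum-mono column) ⟩
    sum (λ j → a * (w j * y j)) + p * η * sum w          ≡⟨ cong (_+ p * η * sum w) (sym (*-distribˡ-sum a
          (λ j → w j * y j))) ⟩
    a * S + p * η * sum w                                ∎)
    where
    open ℚₚ.≤-Reasoning
    open +-*-Solver
    S = sum (λ i → w i * y i)
    B = λ i j → p * (w i * (A i j * y j))
    row : ∀ i → (a + 1ℚ) * (w i * y i) ≤ sum (λ j → B i j) + p * η * w i
    row i = begin
      (a + 1ℚ) * (w i * y i)                             ≡⟨ solve 3 (λ a w y → a :* (w :* y) := w :*
            (a :* y)) refl (a + 1ℚ) (w i) (y i) ⟩
      w i * ((a + 1ℚ) * y i)                             ≤⟨ *-monoˡ (0≤w i) (approx i) ⟩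
      w i * (p * (sum (λ j → A i j * y j) + η))          ≡⟨ solve 4 (λ w p s η → w :* (p :* (s :+ η)) := p :*
            (w :* s) :+ p :* η :* w) refl (w i) p _ η ⟩
      p * (w i * sum (λ j → A i j * y j)) + p * η * w i  ≡⟨ cong (λ z → p * z + p * η * w i) (*-distribˡ-sum
            (w i) (λ j → A i j * y j)) ⟩
      p * sum (λ j → w i * (A i j * y j)) + p * η * w i  ≡⟨ cong (_+ p * η * w i) (*-distribˡ-sum p
            (λ j → w i * (A i j * y j))) ⟩
      sum (λ j → B i j) + p * η * w i ∎
    column : ∀ j → sum (λ i → B i j) ≤ a * (w j * y j)
    column j = begin
      sum (λ i → B i j)              ≡⟨ sum-cong-≗ (λ i → trans (cong (λ z → p * (w i * (z * y j))) (A-sym i j))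
                                                              (solve 4 (λ p w A y → p :* (w :* (A :* y)) :=
                                                                    (y :* p) :* (A :* w)) refl p (w i) (A j i)
                                                                    (y j))) ⟩
      sum (λ i → (y j * p) * (A j i * w i))              ≡⟨ *-distribˡ-sum (y j * p) (λ i → A j i * w i) ⟨
      (y j * p) * sum (λ i → A j i * w i)                ≡⟨ ℚₚ.*-assoc (y j) p _ ⟩
      y j * (p * sum (λ i → A j i * w i))                ≤⟨ *-monoˡ (0≤y j) (super j) ⟩
      y j * (a * w j)                                    ≡⟨ solve 3 (λ y a w → y :* (a :* w) := a :*
            (w :* y)) refl (y j) a (w j) ⟩
      a * (w j * y j)                                    ∎

  -- Eigenvalues of an adjacency matrix against positive weights.

  ind : Bool → ℕ
  ind b = if b then 1 else 0

  adj : ∀ {m} → SimpleGraph m → Fin m → Fin m → ℕ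
  adj G i j = ind (edge? G (⁅ i ⁆ ∪ ⁅ j ⁆))

  adj-sym : ∀ {m} (G : SimpleGraph m) i j → adj G i j ≡ adj G j i
  adj-sym G i j = cong (ind ∘ edge? G) (∪-comm ⁅ i ⁆ ⁅ j ⁆)

  -- The entries are constant sequences, so at every index the real matrix is an exact matrix of
  -- natural numbers, and only ρ and x are approximated.
  seq-adjacency : ∀ {m} (G : SimpleGraph m) i j n → seq (adjacency G i j) n ≡ ι (adj G i j)
  seq-adjacency G i j n with edge? G (⁅ i ⁆ ∪ ⁅ j ⁆)
  ... | true  = sym (ι-def 1)
  ... | false = sym (ι-def 0)

  seq-foldr : ∀ {m} (f : Fin m → ℝ) n → seq (foldr _+ℝ_ 0ℝ f) n ≡ sum (λ j → seq (f j) n)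
  seq-foldr {zero}  f n = refl
  seq-foldr {suc m} f n = cong (λ z → seq (f Fin.zero) n + z) (seq-foldr (f ∘ Fin.suc) n)

  -- Finitely many thresholds have a maximum, so all coordinates of the eigenvalue equation can be
  -- used at a common index.
  eventually-all : ∀ {m} {P : Fin m → ℕ → Set} →
    (∀ i → ∃ λ N → ∀ n → N ℕ.≤ n → P i n) → ∃ λ N → ∀ n → N ℕ.≤ n → ∀ i → P i n
  eventually-all {zero}  h = 0 , λ _ _ ()
  eventually-all {suc m} h with h Fin.zero | eventually-all (h ∘ Fin.suc)
  ... | M , hM | N , hN = M ℕ.⊔ N , λ where
    n p Fin.zero    → hM n (ℕₚ.m⊔n≤o⇒m≤o M N p)
    n p (Fin.suc i) → hN n (ℕₚ.m⊔n≤o⇒n≤o M N p) i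

  small-multiple : ∀ k ε → 0ℚ < ε → ∃ λ η → 0ℚ < η × ι k * η < ε
  small-multiple k ε 0<ε = η , 0<η , (begin-strict
    ι k * η            ≡⟨ ℚₚ.+-identityˡ _ ⟨
    0ℚ + ι k * η       <⟨ ℚₚ.+-monoˡ-< (ι k * η) 0<η ⟩
    η + ι k * η        ≡⟨ solve 2 (λ k η → η :+ k :* η := (con 1ℚ :+ k) :* η) refl (ι k) η ⟩
    (1ℚ + ι k) * η     ≡⟨ cong (λ z → (z + ι k) * η) (ι-def 1) ⟨
    (ι 1 + ι k) * η    ≡⟨ cong (_* η) (ι-+ 1 k) ⟨
    ι (suc k) * ((+ 1 / suc k) * ε) ≡⟨ ℚₚ.*-assoc (ι (suc k)) (+ 1 / suc k) ε ⟨
    ι (suc k) * (+ 1 / suc k) * ε   ≡⟨ cong (_* ε) (trans (ι*/ 1 k) (ι-def 1)) ⟩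
    1ℚ * ε             ≡⟨ ℚₚ.*-identityˡ ε ⟩
    ε                  ∎)
    where
    open ℚₚ.≤-Reasoning
    open +-*-Solver
    -- Dividing by k + 1 instead of k covers k = 0 and makes the inequality strict.
    η = (+ 1 / suc k) * ε
    0<η : 0ℚ < η
    0<η = ℚₚ.positive⁻¹ η {{ℚₚ.pos*pos⇒pos (+ 1 / suc k) {{ℚₚ.normalize-pos 1 (suc k)}} ε {{positive 0<ε}}}}

  r≡s-[s-r] : ∀ r s → r ≡ s - (s - r)
  r≡s-[s-r] = solve 2 (λ r s → r := s :- (s :- r)) refl
    where open +-*-Solver

  -- Let y consist of the absolute values of the coordinates of x at a late index. The eigenvalue
  -- equation holds there up to η, so (a + 1) y ≤ p (A y + η) in every row, and `pairing-bound`
  -- makes the sum of w y at most p η times the total weight. Since η is arbitrary, x would be 0.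
  eigenvalue-bound : ∀ {m} (G : SimpleGraph m) ρ → IsEigenvalue (adjacency G) ρ →
    (ω : Fin m → ℕ) → (∀ i → 0 ℕ.< ω i) → ∀ a p →
    (∀ i → p ℕ.* ℕ-Sum.sum (λ j → adj G i j ℕ.* ω j) ℕ.≤ a ℕ.* ω i) →
    ∀ N → ¬ (∀ n → N ℕ.≤ n → ι a + 1ℚ ≤ ι p * seq ρ n)
  eigenvalue-bound {m} G ρ (x , x≢0 , Ax≈ρx) ω 0<ω a p super N ρ-large = x≢0 x≈0
    where
    open ℚₚ.≤-Reasoning
    open +-*-Solver
    A : Fin m → Fin m → ℚ
    A i j = ι (adj G i j)
    w = ι ∘ ω
    0≤w : ∀ i → 0ℚ ≤ w i
    0≤w i = 0≤ι (ω i)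
    W = ℕ-Sum.sum ω
    super′ : ∀ i → ι p * sum (λ j → A i j * w j) ≤ ι a * w i
    super′ i = subst₂ _≤_
      (trans (ι-* p _) (cong (ι p *_) (trans (ι-sum (λ j → adj G i j ℕ.* ω j)) (sum-cong-≗ (λ j → ι-*
            (adj G i j) (ω j))))))
      (ι-* a (ω i)) (ι-mono (super i))
    x≈0 : ∀ i → x i ≈ℝ 0ℝ
    x≈0 i ε 0<ε =
      -- The factor p W is the one that multiplies η in `pairing-bound`, W being the total weight.
      let η , 0<η , small = small-multiple (p ℕ.* W) ε 0<ε
          M , close = eventually-all {P = λ k n → ∣ seq ((adjacency G *ᵥ x) k) n - seq ρ n * seq (x k) n ∣ℚ < η}
                        (λ k → Ax≈ρx k η 0<η)
      in M ℕ.⊔ N , λ n q → bound i ε η M small close n (ℕₚ.m⊔n≤o⇒m≤o M N q) (ℕₚ.m⊔n≤o⇒n≤o M N q)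
      where
      bound : ∀ i ε η M → ι (p ℕ.* W) * η < ε →
        (∀ n → M ℕ.≤ n → ∀ k → ∣ seq ((adjacency G *ᵥ x) k) n - seq ρ n * seq (x k) n ∣ℚ < η) →
        ∀ n → M ℕ.≤ n → N ℕ.≤ n → ∣ seq (x i) n - 0ℚ ∣ℚ < ε
      bound i ε η M small close n M≤n N≤n = begin-strict
        ∣ seq (x i) n - 0ℚ ∣ℚ        ≡⟨ cong ∣_∣ℚ (ℚₚ.+-identityʳ (seq (x i) n)) ⟩
        y i                          ≡⟨ ℚₚ.*-identityˡ (y i) ⟨
        1ℚ * y i                     ≤⟨ ℚₚ.*-monoʳ-≤-nonNeg (y i) {{ℚₚ.∣-∣-nonNeg (seq (x i) n)}} (subst
              (_≤ w i) (ι-def 1) (ι-mono (0<ω i))) ⟩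
        w i * y i                    ≤⟨ term≤sum (λ k → *-nonNeg (0≤w k) (0≤y k)) i ⟩
        sum (λ k → w k * y k)        ≤⟨ pairing-bound A (λ k j → cong ι (adj-sym G k j)) w y (ι a)
              (ι p) η 0≤w 0≤y super′ approx ⟩
        ι p * η * sum w              ≡⟨ cong (ι p * η *_) (ι-sum ω) ⟨
        ι p * η * ι W                ≡⟨ solve 3 (λ p η W → p :* η :* W := (p :* W) :* η) refl (ι p) η (ι W) ⟩
        ι p * ι W * η                ≡⟨ cong (_* η) (ι-* p W) ⟨
        ι (p ℕ.* W) * η              <⟨ small ⟩
        ε                            ∎
        where
        y : Fin m → ℚ
        y k = ∣ seq (x k) n ∣ℚ
        0≤y : ∀ k → 0ℚ ≤ y k
        0≤y k = ℚₚ.0≤∣p∣ (seq (x k) n)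
        approx : ∀ k → (ι a + 1ℚ) * y k ≤ ι p * (sum (λ j → A k j * y j) + η)
        -- Triangle inequality: ρ |x_k| ≤ |ρ x_k| ≤ |(A x)_k| + η ≤ (A |x|)_k + η, as A has
        -- nonnegative entries.
        approx k = begin
          (ι a + 1ℚ) * y k               ≤⟨ ℚₚ.*-monoʳ-≤-nonNeg (y k) {{ℚₚ.∣-∣-nonNeg (seq (x k) n)}}
                (ρ-large n N≤n) ⟩
          ι p * seq ρ n * y k            ≡⟨ ℚₚ.*-assoc (ι p) (seq ρ n) (y k) ⟩
          ι p * (seq ρ n * y k)          ≤⟨ *-monoˡ (0≤ι p) (begin
            seq ρ n * y k                  ≤⟨ ℚₚ.*-monoʳ-≤-nonNeg (y k) {{ℚₚ.∣-∣-nonNeg (seq (x k) n)}} (p≤∣p∣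
                  (seq ρ n)) ⟩
            ∣ seq ρ n ∣ℚ * y k             ≡⟨ ℚₚ.∣p*q∣≡∣p∣*∣q∣ (seq ρ n) (seq (x k) n) ⟨
            ∣ seq ρ n * seq (x k) n ∣ℚ     ≡⟨ cong ∣_∣ℚ (r≡s-[s-r] (seq ρ n * seq (x k) n) Sk) ⟩
            ∣ Sk - (Sk - seq ρ n * seq (x k) n) ∣ℚ ≤⟨ ℚₚ.∣p-q∣≤∣p∣+∣q∣ Sk (Sk - seq ρ n * seq (x k) n) ⟩
            ∣ Sk ∣ℚ + ∣ Sk - seq ρ n * seq (x k) n ∣ℚ ≤⟨ ℚₚ.+-mono-≤ absSk (ℚₚ.<⇒≤ (close n M≤n k)) ⟩
            sum (λ j → A k j * y j) + η    ∎) ⟩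
          ι p * (sum (λ j → A k j * y j) + η) ∎
          where
          Sk = seq ((adjacency G *ᵥ x) k) n
          absSk : ∣ Sk ∣ℚ ≤ sum (λ j → A k j * y j)
          absSk = begin
            ∣ Sk ∣ℚ                                ≡⟨ cong ∣_∣ℚ (seq-foldr (λ j → adjacency G k j *ℝ x j) n) ⟩
            ∣ sum (λ j → seq (adjacency G k j) n * seq (x j) n) ∣ℚ
                                                   ≤⟨ ∣sum∣≤ (λ j → seq (adjacency G k j) n * seq (x j) n) ⟩
            sum (λ j → ∣ seq (adjacency G k j) n * seq (x j) n ∣ℚ)
                                                   ≡⟨ sum-cong-≗ (λ j → trans (ℚₚ.∣p*q∣≡∣p∣*∣q∣ (seq
                                                         (adjacency G k j) n) (seq (x j) n))
                                                        (cong (_* y j) (trans (cong ∣_∣ℚ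
                                                              (seq-adjacency G k j n)) (ℚₚ.0≤p⇒∣p∣≡p (0≤ι
                                                              (adj G k j)))))) ⟩
            sum (λ j → A k j * y j)                ∎

  -- A rational number between the threshold and the spectral radius.

  -- The 2 pays for two units in `rational-threshold`: the rounding of r up to r + 1, and the gap 1
  -- that `eigenvalue-bound` asks for. Taking k ≥ M puts the k-th approximation of √D within ε of
  -- all later ones.
  archimedean : ∀ ε → 0ℚ < ε → ∀ M → ∃ λ k → M ℕ.≤ k × 1ℚ + 1ℚ ≤ ι (suc k) * ε
  archimedean (mkℚ (+ 0) d c) (*<* (ℤ.+<+ ()))
  archimedean (mkℚ ℤ.-[1+ _ ] d c) (*<* ())
  archimedean (mkℚ +[1+ j ] d c) _ M =
    -- The successor of this number is (d + 1)(M + 2), a multiple of the denominator of ε; times ε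
    -- it is (M + 2)(j + 1) ≥ 2.
    suc M ℕ.+ d ℕ.* (2 ℕ.+ M) , ℕₚ.m≤n⇒m≤n+o _ (ℕₚ.n≤1+n M) ,
    large (mkℚ +[1+ j ] d c) (ℚₚ.↥p/↧p≡p (mkℚ +[1+ j ] d c))
    where
    open ℚₚ.≤-Reasoning
    open +-*-Solver
    large : ∀ ε → + suc j / suc d ≡ ε → 1ℚ + 1ℚ ≤ ι (suc d ℕ.* (2 ℕ.+ M)) * ε
    large ε eq = begin
      1ℚ + 1ℚ                                  ≡⟨ trans (ι-+ 1 1) (cong₂ _+_ (ι-def 1) (ι-def 1)) ⟨
      ι 2                                      ≤⟨ ι-mono (ℕₚ.≤-trans (ℕₚ.m≤m+n 2 M) (ℕₚ.m≤m*n (2 ℕ.+ M) (suc j))) ⟩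
      ι ((2 ℕ.+ M) ℕ.* suc j)                  ≡⟨ ι-* (2 ℕ.+ M) (suc j) ⟩
      ι (2 ℕ.+ M) * ι (suc j)                  ≡⟨ cong (ι (2 ℕ.+ M) *_) (trans (sym (ι*/ (suc j) d)) (cong (ι
            (suc d) *_) eq)) ⟩
      ι (2 ℕ.+ M) * (ι (suc d) * ε)            ≡⟨ solve 3 (λ m d e → m :* (d :* e) := d :* m :* e) refl (ι
            (2 ℕ.+ M)) (ι (suc d)) ε ⟩
      ι (suc d) * ι (2 ℕ.+ M) * ε              ≡⟨ cong (_* ε) (ι-* (suc d) (2 ℕ.+ M)) ⟨
      ι (suc d ℕ.* (2 ℕ.+ M)) * ε              ∎

  p≤q+∣p-q∣ : ∀ p q → p ≤ q + ∣ p - q ∣ℚ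
  p≤q+∣p-q∣ p q = subst (_≤ q + ∣ p - q ∣ℚ) (solve 2 (λ p q → q :+ (p :- q) := p) refl p q)
    (ℚₚ.+-monoʳ-≤ q (p≤∣p∣ (p - q)))
    where open +-*-Solver

  -- The integer r is ⌊√D P⌋, so (t P + r + 1) / (2 P) is a rational upper bound for
  -- (t + √D) / 2 which, for P large, is still smaller than ρ.
  rational-threshold : ∀ t D ρ → fromℚ ½ *ℝ (fromℕ t +ℝ √ D) <ℝ ρ →
    ∃ λ k → ∃ λ r → D ℕ.* (suc k ℕ.* suc k) ℕ.< suc r ℕ.* suc r ×
    ∃ λ N → ∀ n → N ℕ.≤ n → ι (t ℕ.* suc k ℕ.+ suc r) + 1ℚ ≤ ι (2 ℕ.* suc k) * seq ρ n
  rational-threshold t D ρ (ε , 0<ε , N , gap) =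
    let N′ , close = cauchy (√ D) ε 0<ε
        k , N′≤k , 2≤Pε = archimedean ε 0<ε N′
    in k , ⌊√ D ℕ.* (suc k ℕ.* suc k) ⌋ , ⌊√⌋-upper (D ℕ.* (suc k ℕ.* suc k)) , N ℕ.⊔ N′ , λ n q →
         bound k 2≤Pε n (ℚₚ.<⇒≤ (close k n N′≤k (ℕₚ.m⊔n≤o⇒n≤o N N′ q))) (gap n (ℕₚ.m⊔n≤o⇒m≤o N N′ q))
    where
    open ℚₚ.≤-Reasoning
    x = √-approx D
    bound : ∀ k → 1ℚ + 1ℚ ≤ ι (suc k) * ε → ∀ n → ∣ x k - x n ∣ℚ ≤ ε →
      ½ * (+ t / 1 + x n) + ε < seq ρ n →
      ι (t ℕ.* suc k ℕ.+ suc ⌊√ D ℕ.* (suc k ℕ.* suc k) ⌋) + 1ℚ ≤ ι (2 ℕ.* suc k) * seq ρ n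
    bound k 2≤Pε n close gap = begin
      ι (t ℕ.* suc k ℕ.+ suc r) + 1ℚ            ≡⟨ cong (_+ 1ℚ) (trans (ι-+ (t ℕ.* suc k) (suc r)) (cong₂ _+_
            (ι-* t (suc k)) (trans (ι-+ 1 r) (cong (_+ ι r) (ι-def 1))))) ⟩
      ι t * P + (1ℚ + ι r) + 1ℚ                 ≡⟨ solve 2 (λ T r → T :+ (con 1ℚ :+ r) :+ con 1ℚ := T :+ r :+
            (con 1ℚ :+ con 1ℚ)) refl (ι t * P) (ι r) ⟩
      ι t * P + ι r + (1ℚ + 1ℚ)                 ≤⟨ ℚₚ.+-mono-≤ (ℚₚ.+-monoʳ-≤ (ι t * P) (begin
        ι r                                       ≡⟨ ι*/ r k ⟨
        P * x k                                   ≤⟨ *-monoˡ (0≤ι (suc k)) (ℚₚ.≤-trans (p≤q+∣p-q∣ (x k) (x n))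
              (ℚₚ.+-monoʳ-≤ (x n) close)) ⟩
        P * (x n + ε)                             ∎)) 2≤Pε ⟩
      ι t * P + P * (x n + ε) + P * ε           ≡⟨ regroup (ι t) P (x n) ε ⟩
      (1ℚ + 1ℚ) * P * (½ * (ι t + x n) + ε)     ≡⟨ cong₂ (λ u v → u * P * (½ * (v + x n) + ε)) (sym (trans
            (ι-+ 1 1) (cong₂ _+_ (ι-def 1) (ι-def 1)))) (ι-def t) ⟩
      ι 2 * P * (½ * (+ t / 1 + x n) + ε)       ≤⟨ *-monoˡ (*-nonNeg (0≤ι 2) (0≤ι (suc k))) (ℚₚ.<⇒≤ gap) ⟩
      ι 2 * P * seq ρ n                         ≡⟨ cong (_* seq ρ n) (ι-* 2 (suc k)) ⟨
      ι (2 ℕ.* suc k) * seq ρ n                 ∎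
      where
      open +-*-Solver
      r = ⌊√ D ℕ.* (suc k ℕ.* suc k) ⌋
      P = ι (suc k)
      regroup : ∀ t P x e → t * P + P * (x + e) + P * e ≡ (1ℚ + 1ℚ) * P * (½ * (t + x) + e)
      regroup = solve 4 (λ t P x e → t :* P :+ P :* (x :+ e) :+ P :* e := ((con 1ℚ :+ con 1ℚ) :* P) :*
            (con ½ :* (t :+ x) :+ e)) refl

open Spectral using (ι; ind; adj; eigenvalue-bound; rational-threshold)
open import Data.Nat
open import Data.Nat.Properties
open import Data.Nat.Solver using (module +-*-Solver)
open import Algebra.Properties.Semiring.Sum +-*-semiring
  using (sum; sum-remove; ∑-distrib-+; ∑-comm; *-distribˡ-sum; sum-cong-≗)
import Data.Rational as ℚ
open +-*-Solver using (solve; _:+_; _:*_; _:=_; con)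

-- Sums over `Fin n` and sizes of subsets.

private variable
  n : ℕ

sum-mono : {f g : Fin n → ℕ} → (∀ i → f i ≤ g i) → sum f ≤ sum g
sum-mono {zero}  f≤g = z≤n
sum-mono {suc n} f≤g = +-mono-≤ (f≤g Fin.zero) (sum-mono (f≤g ∘ Fin.suc))

sum-const : ∀ n c → sum {n} (λ _ → c) ≡ n * c
sum-const zero    c = refl
sum-const (suc n) c = cong (c +_) (sum-const n c)

sum-punchIn : ∀ (v : Fin (suc n)) (f : Fin (suc n) → ℕ) → sum (f ∘ punchIn v) ≤ sum f
sum-punchIn v f = subst (sum (f ∘ punchIn v) ≤_) (sym (sum-remove {i = v} f)) (m≤n+m _ (f v))

χ : Subset n → Fin n → ℕ
χ p i = ind (lookup p i)

χ-∈ : {p : Subset n} {x : Fin n} → x ∈ p → χ p x ≡ 1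
χ-∈ x∈p = cong ind ([]=⇒lookup x∈p)

χ-∉ : {p : Subset n} {x : Fin n} → x ∉ p → χ p x ≡ 0
χ-∉ {p = p} {x} x∉p with lookup p x in eq
... | true  = contradiction (lookup⇒[]= x p eq) x∉p
... | false = refl

ind≤1 : ∀ b → ind b ≤ 1
ind≤1 true  = ≤-refl
ind≤1 false = z≤n

∣p∣≡sum : (p : Subset n) → ∣ p ∣ ≡ sum (χ p)
∣p∣≡sum []            = refl
∣p∣≡sum (inside  ∷ p) = cong suc (∣p∣≡sum p)
∣p∣≡sum (outside ∷ p) = ∣p∣≡sum p

χ-∩ : (p q : Subset n) (i : Fin n) → χ (p ∩ q) i ≡ χ p i * χ q i
χ-∩ (inside  ∷ p) (y ∷ q) Fin.zero = sym (+-identityʳ (ind y))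
χ-∩ (outside ∷ p) (y ∷ q) Fin.zero = refl
χ-∩ (x ∷ p) (y ∷ q) (Fin.suc i) = χ-∩ p q i

∣p∪q∣≤∣p∣+∣q∣ : (p q : Subset n) → ∣ p ∪ q ∣ ≤ ∣ p ∣ + ∣ q ∣
∣p∪q∣≤∣p∣+∣q∣ []            []            = z≤n
∣p∪q∣≤∣p∣+∣q∣ (inside  ∷ p) (y       ∷ q) =
  s≤s (≤-trans (∣p∪q∣≤∣p∣+∣q∣ p q) (+-monoʳ-≤ ∣ p ∣ (∣p∣≤∣x∷p∣ y q)))
∣p∪q∣≤∣p∣+∣q∣ (outside ∷ p) (inside  ∷ q) =
  ≤-trans (s≤s (∣p∪q∣≤∣p∣+∣q∣ p q)) (≤-reflexive (sym (+-suc ∣ p ∣ ∣ q ∣)))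
∣p∪q∣≤∣p∣+∣q∣ (outside ∷ p) (outside ∷ q) = ∣p∪q∣≤∣p∣+∣q∣ p q

select : {P : Fin n → Set} → (∀ i → Dec (P i)) → Subset n
select P? = tabulate (does ∘ P?)

∈-select⁺ : {P : Fin n → Set} (P? : ∀ i → Dec (P i)) {i : Fin n} → P i → i ∈ select P?
∈-select⁺ P? {i} pi = lookup⇒[]= i _ (trans (lookup∘tabulate _ i) (dec-true (P? i) pi))

∈-select⁻ : {P : Fin n → Set} (P? : ∀ i → Dec (P i)) {i : Fin n} → i ∈ select P? → P i
∈-select⁻ P? {i} i∈ with P? i | trans (sym (lookup∘tabulate (does ∘ P?) i)) ([]=⇒lookup i∈)
... | yes pi | _ = pi
... | no  _  | ()

escape : {p q : Subset n} → ∣ p ∣ < ∣ q ∣ → ∃ λ x → x ∈ q × x ∉ p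
escape {p = p} {q} p<q with any? (λ x → (x ∈? q) ×-dec ¬? (x ∈? p))
... | yes found = found
... | no  none  = contradiction (p⊆q⇒∣p∣≤∣q∣ q⊆p) (<⇒≱ p<q)
  where
  q⊆p : q ⊆ p
  q⊆p {x} x∈q with x ∈? p
  ... | yes x∈p = x∈p
  ... | no  x∉p = contradiction (x , x∈q , x∉p) none

split-element : ∀ {r} (p : Subset n) → ∣ p ∣ ≡ suc r →
  ∃ λ x → ∃ λ q → x ∈ p × x ∉ q × q ⊆ p × ∣ q ∣ ≡ r
split-element (inside  ∷ p) eq =
  Fin.zero , outside ∷ p , here , (λ ()) , (λ { (there x∈p) → there x∈p }) , suc-injective eq
split-element (outside ∷ p) eq with split-element p eq
... | x , q , x∈p , x∉q , q⊆p , ∣q∣ =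
  Fin.suc x , outside ∷ q , there x∈p , (λ { (there x∈q) → x∉q x∈q }) , (λ { (there y∈q) → there (q⊆p y∈q) }) , ∣q∣

sub-of-size : ∀ {r} (p : Subset n) → r ≤ ∣ p ∣ → ∃ λ q → q ⊆ p × ∣ q ∣ ≡ r
sub-of-size {n} {zero} p _ = Subset.⊥ , (λ x∈⊥ → contradiction x∈⊥ ∉⊥) , ∣⊥∣≡0 n
sub-of-size {r = suc r} (inside ∷ p) (s≤s r≤) with sub-of-size p r≤
... | q , q⊆p , ∣q∣ = inside ∷ q , (λ { here → here ; (there x∈q) → there (q⊆p x∈q) }) , cong suc ∣q∣
sub-of-size {r = suc r} (outside ∷ p) r≤ with sub-of-size p r≤
... | q , q⊆p , ∣q∣ = outside ∷ q , (λ { (there x∈q) → there (q⊆p x∈q) }) , ∣q∣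

-- Disjointness, triples of vertices and edges of the link.

Disjoint : Subset n → Subset n → Set
Disjoint p q = Empty (p ∩ q)

disjoint⁺ : {p q : Subset n} → (∀ {x} → x ∈ p → x ∉ q) → Disjoint p q
disjoint⁺ {p = p} {q} h (x , x∈p∩q) = let x∈p , x∈q = x∈p∩q⁻ p q x∈p∩q in h x∈p x∈q

disjoint⁻ : {p q : Subset n} {x : Fin n} → Disjoint p q → x ∈ p → x ∉ q
disjoint⁻ d x∈p x∈q = d (_ , x∈p∩q⁺ (x∈p , x∈q))

-- Coinciding arguments are allowed: the set then has fewer than three elements and cannot be an
-- edge.
triple : Fin n → Fin n → Fin n → Subset n
triple x y z = ⁅ x ⁆ ∪ (⁅ y ⁆ ∪ ⁅ z ⁆)

triple-∈⁻ : {x y z u : Fin n} → u ∈ triple x y z → u ≡ x ⊎ u ≡ y ⊎ u ≡ z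
triple-∈⁻ {x = x} {y} {z} u∈ with x∈p∪q⁻ ⁅ x ⁆ _ u∈
... | inj₁ p = inj₁ (x∈⁅y⁆⇒x≡y x p)
... | inj₂ q with x∈p∪q⁻ ⁅ y ⁆ ⁅ z ⁆ q
...   | inj₁ p = inj₂ (inj₁ (x∈⁅y⁆⇒x≡y y p))
...   | inj₂ p = inj₂ (inj₂ (x∈⁅y⁆⇒x≡y z p))

triple-swap₁₂ : (x y z : Fin n) → triple x y z ≡ triple y x z
triple-swap₁₂ x y z = trans (sym (∪-assoc ⁅ x ⁆ ⁅ y ⁆ ⁅ z ⁆))
  (trans (cong (_∪ ⁅ z ⁆) (∪-comm ⁅ x ⁆ ⁅ y ⁆)) (∪-assoc ⁅ y ⁆ ⁅ x ⁆ ⁅ z ⁆))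

triple-swap₂₃ : (x y z : Fin n) → triple x y z ≡ triple x z y
triple-swap₂₃ x y z = cong (⁅ x ⁆ ∪_) (∪-comm ⁅ y ⁆ ⁅ z ⁆)

∣pair∣≤2 : (x y : Fin n) → ∣ ⁅ x ⁆ ∪ ⁅ y ⁆ ∣ ≤ 2
∣pair∣≤2 x y = ≤-trans (∣p∪q∣≤∣p∣+∣q∣ ⁅ x ⁆ ⁅ y ⁆) (≤-reflexive (cong₂ _+_ (∣⁅x⁆∣≡1 x) (∣⁅x⁆∣≡1 y)))

insertAt-⊥ : (v : Fin (suc n)) → insertAt Subset.⊥ v outside ≡ Subset.⊥
insertAt-⊥ Fin.zero = refl
insertAt-⊥ {suc n} (Fin.suc v) = cong (outside ∷_) (insertAt-⊥ v)

insertAt-⁅⁆ : (v : Fin (suc n)) (i : Fin n) → insertAt ⁅ i ⁆ v outside ≡ ⁅ punchIn v i ⁆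
insertAt-⁅⁆ Fin.zero    i           = refl
insertAt-⁅⁆ (Fin.suc v) Fin.zero    = cong (inside ∷_) (insertAt-⊥ v)
insertAt-⁅⁆ (Fin.suc v) (Fin.suc i) = cong (outside ∷_) (insertAt-⁅⁆ v i)

insertAt-∪ : (v : Fin (suc n)) (p q : Subset n) →
  insertAt (p ∪ q) v inside ≡ ⁅ v ⁆ ∪ (insertAt p v outside ∪ insertAt q v outside)
insertAt-∪ Fin.zero    p       q       = cong (inside ∷_) (sym (∪-identityˡ (p ∪ q)))
insertAt-∪ (Fin.suc v) (x ∷ p) (y ∷ q) = cong (_ ∷_) (insertAt-∪ v p q)

-- Translates a pair in the vertex numbering of the link of v into a triple of original vertices.
insertAt-pair : (v : Fin (suc n)) (i j : Fin n) →
  insertAt (⁅ i ⁆ ∪ ⁅ j ⁆) v inside ≡ triple v (punchIn v i) (punchIn v j)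
insertAt-pair v i j = trans (insertAt-∪ v ⁅ i ⁆ ⁅ j ⁆)
  (cong (⁅ v ⁆ ∪_) (cong₂ _∪_ (insertAt-⁅⁆ v i) (insertAt-⁅⁆ v j)))

-- Matchings, greedy extension, heavy pairs and big vertices.

module _ (H : ThreeGraph n) where

  -- With x = y the triple collapses to a pair, while an edge has three elements.
  triple-distinct : ∀ {x y z} → IsEdge H (triple x y z) → x ≢ y
  triple-distinct {x} {y} {z} e refl = <⇒≱ (s≤s (∣pair∣≤2 x z))
    (≤-reflexive (trans (sym (uniform H _ e))
      (cong ∣_∣ (trans (sym (∪-assoc ⁅ x ⁆ ⁅ x ⁆ ⁅ z ⁆)) (cong (_∪ ⁅ z ⁆) (∪-idem ⁅ x ⁆))))))

  ∣⋃∣≤ : ∀ {M} → IsMatching H M → ∣ ⋃ M ∣ ≤ 3 * length M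
  ∣⋃∣≤ (edges , _) = go edges
    where
    go : ∀ {M} → All (IsEdge H) M → ∣ ⋃ M ∣ ≤ 3 * length M
    go [] = ≤-reflexive (∣⊥∣≡0 n)
    go {e ∷ M} (edge ∷ edges) = ≤-trans (∣p∪q∣≤∣p∣+∣q∣ e (⋃ M))
      (≤-trans (+-mono-≤ (≤-reflexive (uniform H e edge)) (go edges))
        (≤-reflexive (sym (*-suc 3 (length M)))))

  cons-matching : ∀ {e M} → IsEdge H e → Disjoint e (⋃ M) → IsMatching H M → IsMatching H (e ∷ M)
  cons-matching {e} edge d (edges , pairs) = edge ∷ edges , go _ d ∷ pairs
    where
    go : ∀ M → Disjoint e (⋃ M) → All (Disjoint e) M
    go []      d = []
    go (f ∷ M) d = disjoint⁺ (λ x∈e x∈f → disjoint⁻ d x∈e (x∈p∪q⁺ (inj₁ x∈f)))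
                 ∷ go M (disjoint⁺ (λ x∈e x∈M → disjoint⁻ d x∈e (x∈p∪q⁺ (inj₂ x∈M))))

  MatchingAvoiding : ℕ → Subset n → Set
  MatchingAvoiding j X = ∃ λ M → IsMatching H M × length M ≡ j × Disjoint (⋃ M) X

  cons-avoiding : ∀ {e M X} → IsEdge H e → Disjoint e (⋃ M ∪ X) → IsMatching H M → Disjoint (⋃ M) X →
    MatchingAvoiding (suc (length M)) X
  cons-avoiding {e} {M} {X} edge e-d M-match M-d =
    e ∷ M , cons-matching edge (disjoint⁺ (λ x∈e → disjoint⁻ e-d x∈e ∘ x∈p∪q⁺ ∘ inj₁)) M-match , refl ,
    disjoint⁺ λ x∈ → avoid (x∈p∪q⁻ e (⋃ M) x∈)
    where
    avoid : ∀ {x} → x ∈ e ⊎ x ∈ ⋃ M → x ∉ X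
    avoid (inj₁ x∈e) x∈X = disjoint⁻ e-d x∈e (x∈p∪q⁺ (inj₂ x∈X))
    avoid (inj₂ x∈M)     = disjoint⁻ M-d x∈M

  -- The last component is maximality under inclusion, in the form in which it is used later:
  -- `⋃ M ∪ X` meets every edge.
  MaximalAvoiding : List (Subset n) → Subset n → Set
  MaximalAvoiding M X = IsMatching H M × Disjoint (⋃ M) X × (∀ e → IsEdge H e → ¬ Disjoint e (⋃ M ∪ X))

  -- Edges are added one at a time. Either t of them fit, or the process is stuck earlier, and being
  -- stuck is maximality.
  greedy : ∀ t X → MatchingAvoiding t X ⊎ ∃ λ M → length M < t × MaximalAvoiding M X
  greedy zero    X = inj₁ ([] , ([] , []) , refl , disjoint⁺ (λ x∈⊥ → contradiction x∈⊥ ∉⊥))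
  greedy (suc t) X with greedy t X
  ... | inj₂ (M , <t , maximal) = inj₂ (M , m<n⇒m<1+n <t , maximal)
  ... | inj₁ (M , M-match , refl , M-d) with anySubset? (λ e → T? (edge? H e) ×-dec ¬? (nonempty? (e ∩ (⋃ M ∪ X))))
  ...   | yes (e , edge , d) = inj₁ (cons-avoiding edge d M-match M-d)
  ...   | no  none = inj₂ (M , ≤-refl , M-match , M-d , λ e edge d → none (e , edge , d))

  -- Its size is the codegree of x and y. It is also the neighbourhood of y in the link of x, which
  -- is how codegrees become degrees in links.
  neighbours : Fin n → Fin n → Subset n
  neighbours x y = select (λ z → T? (edge? H (triple x y z)))

  neighbours⁻ : ∀ {x y z} → z ∈ neighbours x y → IsEdge H (triple x y z)
  neighbours⁻ {x} {y} = ∈-select⁻ (λ z → T? (edge? H (triple x y z)))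

  neighbours-sym : ∀ x y → neighbours x y ≡ neighbours y x
  neighbours-sym x y = tabulate-cong (λ z → cong (edge? H) (triple-swap₁₂ x y z))

  heavy : ℕ → Fin n → Subset n
  heavy d x = select (λ y → d <? ∣ neighbours x y ∣)

  big : ℕ → Subset n
  big d = select (λ x → d <? ∣ heavy d x ∣)

  heavy⁻ : ∀ {d x y} → y ∈ heavy d x → d < ∣ neighbours x y ∣
  heavy⁻ {d} {x} = ∈-select⁻ (λ y → d <? ∣ neighbours x y ∣)

  heavy⁺ : ∀ {d x y} → d < ∣ neighbours x y ∣ → y ∈ heavy d x
  heavy⁺ {d} {x} = ∈-select⁺ (λ y → d <? ∣ neighbours x y ∣)

  heavy-sym : ∀ {d x y} → y ∈ heavy d x → x ∈ heavy d y
  heavy-sym {d} {x} {y} y∈ = heavy⁺ (subst (λ N → d < ∣ N ∣) (neighbours-sym x y) (heavy⁻ y∈))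

  big⁻ : ∀ {d x} → x ∈ big d → d < ∣ heavy d x ∣
  big⁻ {d} = ∈-select⁻ (λ x → d <? ∣ heavy d x ∣)

  big⁺ : ∀ {d x} → d < ∣ heavy d x ∣ → x ∈ big d
  big⁺ {d} = ∈-select⁺ (λ x → d <? ∣ heavy d x ∣)

  -- Each step trades a big vertex b of Y for an edge b v u, where v is a heavy partner of b and u
  -- completes the pair to an edge, both outside the set Z of vertices already matched or still
  -- reserved. The invariant j + r = s + 1 keeps |Z| ≤ 3s, which the number of heavy partners of b
  -- and the codegree of b and v both exceed.
  absorb : ∀ s r j Y → ∣ Y ∣ ≡ r → Y ⊆ big (3 * s) → MatchingAvoiding j Y → j + r ≡ suc s →
    MatchingAvoiding (suc s) Subset.⊥
  absorb s zero j Y _ _ (M , M-match , len , _) eq =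
    M , M-match , trans len (trans (sym (+-identityʳ j)) eq) , disjoint⁺ (λ _ → ∉⊥)
  absorb s (suc r) j Y ∣Y∣ Y⊆big (M , M-match , refl , M-d) eq with split-element Y ∣Y∣
  ... | b , X , b∈Y , b∉X , X⊆Y , ∣X∣ =
    absorb s r (suc j) X ∣X∣ (Y⊆big ∘ X⊆Y)
      (cons-avoiding (neighbours⁻ u∈) (disjoint⁺ (λ x∈ → avoid (triple-∈⁻ x∈))) M-match
        (disjoint⁺ (λ x∈M → disjoint⁻ M-d x∈M ∘ X⊆Y)))
      (trans (sym (+-suc j r)) eq)
    where
    Z = ⋃ M ∪ X
    ∣Z∣≤ : ∣ Z ∣ ≤ 3 * s
    ∣Z∣≤ = begin
      ∣ Z ∣                ≤⟨ ∣p∪q∣≤∣p∣+∣q∣ (⋃ M) X ⟩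
      ∣ ⋃ M ∣ + ∣ X ∣      ≤⟨ +-mono-≤ (∣⋃∣≤ M-match) (≤-trans (≤-reflexive ∣X∣) (m≤n*m r 3)) ⟩
      3 * j + 3 * r        ≡⟨ *-distribˡ-+ 3 j r ⟨
      3 * (j + r)          ≡⟨ cong (3 *_) (suc-injective (trans (sym (+-suc j r)) eq)) ⟩
      3 * s                ∎
      where open ≤-Reasoning
    heavy-pair = escape {p = Z} {heavy (3 * s) b} (≤-<-trans ∣Z∣≤ (big⁻ (Y⊆big b∈Y)))
    v = proj₁ heavy-pair
    new-edge = escape {p = Z} {neighbours b v} (≤-<-trans ∣Z∣≤ (heavy⁻ (proj₁ (proj₂ heavy-pair))))
    u = proj₁ new-edge
    u∈ = proj₁ (proj₂ new-edge)
    b∉Z : b ∉ Z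
    b∉Z b∈ with x∈p∪q⁻ (⋃ M) X b∈
    ... | inj₁ b∈M = disjoint⁻ M-d b∈M b∈Y
    ... | inj₂ b∈X = b∉X b∈X
    avoid : ∀ {x} → x ≡ b ⊎ x ≡ v ⊎ x ≡ u → x ∉ Z
    avoid (inj₁ refl)        = b∉Z
    avoid (inj₂ (inj₁ refl)) = proj₂ (proj₂ heavy-pair)
    avoid (inj₂ (inj₂ refl)) = proj₂ (proj₂ new-edge)

-- Polynomial inequalities over ℕ.

-- Reduces an inequality to a polynomial identity free of subtraction: X ≤ Y is a sum of known
-- inequalities with nonnegative multipliers, K is the slack, and the ring solver checks the
-- identity.
by-certificate : ∀ {X Y L R} K → X ≤ Y → L + Y + K ≡ R + X → L ≤ R
by-certificate {X} {Y} {L} {R} K X≤Y eq = +-cancelʳ-≤ X L R (begin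
  L + X       ≤⟨ +-monoʳ-≤ L X≤Y ⟩
  L + Y       ≤⟨ m≤m+n (L + Y) K ⟩
  L + Y + K   ≡⟨ eq ⟩
  R + X       ∎)
  where open ≤-Reasoning

-- The threshold is the larger root of q² - t q - s m, where s = t + 1. For q = a / p the conclusion
-- says that this polynomial is nonnegative at q, with denominators cleared; it holds because (2q -
-- t)² = R² / P² exceeds the discriminant.
quadratic-from-root : ∀ t m P R → (t ^ 2 + 4 * suc t * m) * (P * P) < R * R →
  let a = t * P + R ; p = 2 * P in
  suc t * (a * p) + suc t * m * (p * p) ≤ a * a + a * p
quadratic-from-root t m P R D<R² = by-certificate 0 (<⇒≤ D<R²)
  (solve 4 (λ t m P R → let s = con 1 :+ t ; a = t :* P :+ R ; p = con 2 :* P in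
    s :* (a :* p) :+ s :* m :* (p :* p) :+ R :* R :+ con 0 :=
    a :* a :+ a :* p :+ (t :* (t :* con 1) :+ con 4 :* s :* m) :* (P :* P)) refl t m P R)

module Numeric (b k m a p : ℕ) (0<s : 0 < b + k) (0<p : 0 < p) (98s≤m : 98 * (b + k) ≤ m)
  (quadratic : (b + k) * (a * p) + (b + k) * m * (p * p) ≤ a * a + a * p) where

  private
    s = b + k

  -- That is, q ≥ 9s for q = a / p. As s ≥ 1, `quadratic` gives q² ≥ s m ≥ 98 s², and 98 > 81.
  9sp≤a : 9 * (s * p) ≤ a
  9sp≤a = ≮⇒≥ λ a<9sp → contradiction (impossible (<⇒≤ a<9sp)) (λ ())
    where
    q = s * p
    impossible : a ≤ 9 * q → 1 ≤ 0
    -- Here 17 = 98 - 81 copies of (s p)² are left over, each at least 1; the slack 16 is what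
    -- remains beside the 1 of 1 ≤ 0.
    impossible a≤9q = by-certificate 16
      (+-mono-≤ (*-monoˡ-≤ (s * p * p) 98s≤m)
      (+-mono-≤ (*-monoˡ-≤ a a≤9q)
      (+-mono-≤ (*-monoˡ-≤ (a * p) 0<s)
      (+-mono-≤ (*-monoʳ-≤ (9 * q) a≤9q)
      (+-mono-≤ (*-monoʳ-≤ 17 (*-mono-≤ (*-mono-≤ 0<s 0<p) (*-mono-≤ 0<s 0<p))) quadratic)))))
      (solve 4 (λ s a p m → let q = s :* p in
        con 1 :+ (m :* (s :* p :* p) :+ (con 9 :* q :* a :+ (s :* (a :* p) :+ (con 9 :* q :* (con 9 :* q)
          :+ (con 17 :* (q :* q) :+ (a :* a :+ a :* p)))))) :+ con 16 :=
        con 98 :* s :* (s :* p :* p) :+ (a :* a :+ (con 1 :* (a :* p) :+ (con 9 :* q :* a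
          :+ (con 17 :+ (s :* (a :* p) :+ s :* m :* (p :* p)))))))
        refl s a p m)

  module _ {c : ℕ} (4c≤ : 4 * c ≤ 4 * b + k) where

    -- In terms of q: C contributes at most (4b + k) q, and d ≤ 3s further neighbours at most 18 s²
    -- ≤ 2 s q. The total (6b + 3k) q is below 6 s q.
    row-light : ∀ {R d} → d ≤ 3 * s → R ≤ c * (4 * a) + d * (6 * (s * p)) → p * R ≤ a * (6 * (s * p))
    row-light {R} {d} d≤ R≤ = by-certificate (3 * k * a * p)
      (+-mono-≤ (*-monoʳ-≤ p R≤) (+-mono-≤ (*-monoˡ-≤ (p * a) 4c≤)
        (+-mono-≤ (*-monoˡ-≤ (6 * (s * p) * p) d≤) (*-monoˡ-≤ (2 * (s * p)) 9sp≤a))))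
      (solve 7 (λ R c d a p b k → let s = b :+ k in
        p :* R :+ (p :* (c :* (con 4 :* a) :+ d :* (con 6 :* (s :* p))) :+ ((con 4 :* b :+ k) :* (p :* a)
          :+ (con 3 :* s :* (con 6 :* (s :* p) :* p) :+ a :* (con 2 :* (s :* p))))) :+ con 3 :* k :* a :* p :=
        a :* (con 6 :* (s :* p)) :+ (p :* R :+ (con 4 :* c :* (p :* a)
          :+ (d :* (con 6 :* (s :* p) :* p) :+ con 9 :* (s :* p) :* (con 2 :* (s :* p))))))
        refl R c d a p b k)

    module _ {w : ℕ} (w≤3k : w ≤ 3 * k) where

      -- Again C contributes at most (4b + k) q, and W at most 18 s k ≤ 2 k q. The sum is (4b + 3k)
      -- q, whence the choice of the outer weight.
      row-outside : ∀ {R} → R ≤ c * (4 * a) + w * (6 * (s * p)) → p * R ≤ a * ((4 * b + 3 * k) * p)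
      row-outside {R} R≤ = by-certificate 0
        (+-mono-≤ (*-monoʳ-≤ p R≤) (+-mono-≤ (*-monoˡ-≤ (p * a) 4c≤)
          (+-mono-≤ (*-monoˡ-≤ (6 * (s * p) * p) w≤3k) (*-monoˡ-≤ (2 * (k * p)) 9sp≤a))))
        (solve 7 (λ R c w a p b k → let s = b :+ k in
          p :* R :+ (p :* (c :* (con 4 :* a) :+ w :* (con 6 :* (s :* p))) :+ ((con 4 :* b :+ k) :* (p :* a)
            :+ (con 3 :* k :* (con 6 :* (s :* p) :* p) :+ a :* (con 2 :* (k :* p))))) :+ con 0 :=
          a :* ((con 4 :* b :+ con 3 :* k) :* p) :+ (p :* R :+ (con 4 :* c :* (p :* a)
            :+ (w :* (con 6 :* (s :* p) :* p) :+ con 9 :* (s :* p) :* (con 2 :* (k :* p))))))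
          refl R c w a p b k)

      -- Uses four times `quadratic`, whose term 4 a p absorbs the 4 a on the left. Since s - b = k,
      -- the outer vertices number at most k + m here; the leading parts cancel up to k m ≥ 98 s k,
      -- which pays for 18 s k from W and for k (4b + 3k).
      row-core : ∀ {R} → let β = (4 * b + 3 * k) * p in
        R + 4 * a + b * β + β ≤ c * (4 * a) + w * (6 * (s * p)) + (1 + s + m) * β → p * R ≤ a * (4 * a)
      row-core {R} R≤ = by-certificate (3 * k * a * p + 76 * s * k * p * p + k * k * p * p)
        (+-mono-≤ (*-monoʳ-≤ p R≤) (+-mono-≤ (*-monoˡ-≤ (p * a) 4c≤)
          (+-mono-≤ (*-monoˡ-≤ (6 * (s * p) * p) w≤3k) (+-mono-≤ (*-monoʳ-≤ 4 quadratic) (*-monoˡ-≤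
                (k * p * p) 98s≤m)))))
        (solve 8 (λ R c w a p b k m → let s = b :+ k ; β = (con 4 :* b :+ con 3 :* k) :* p in
          p :* R :+ (p :* (c :* (con 4 :* a) :+ w :* (con 6 :* (s :* p)) :+ (con 1 :+ s :+ m) :* β)
            :+ ((con 4 :* b :+ k) :* (p :* a) :+ (con 3 :* k :* (con 6 :* (s :* p) :* p)
            :+ (con 4 :* (a :* a :+ a :* p) :+ m :* (k :* p :* p)))))
            :+ (con 3 :* k :* a :* p :+ con 76 :* s :* k :* p :* p :+ k :* k :* p :* p) :=
          a :* (con 4 :* a) :+ (p :* (R :+ con 4 :* a :+ b :* β :+ β) :+ (con 4 :* c :* (p :* a)
            :+ (w :* (con 6 :* (s :* p) :* p) :+ (con 4 :* (s :* (a :* p) :+ s :* m :* (p :* p))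
            :+ con 98 :* s :* (k :* p :* p))))))
          refl R c w a p b k m)

-- 4 E + (k + 1)(b + w) ≤ 36 s k + 3 s (k + 1) < 100 s (k + 1) ≤ n (k + 1).
averaging-impossible : ∀ {n b k w E} → let s = b + k in 0 < s → 100 * s ≤ n → w ≤ 3 * k → E ≤ w * (3 * s) →
  ¬ (n * suc k ≤ 4 * E + suc k * (b + w))
averaging-impossible {n} {b} {k} {w} {E} 0<s 100s≤n w≤3k E≤ n≤ = contradiction impossible (λ ())
  where
  s = b + k
  impossible : 1 ≤ 0
  impossible = by-certificate (61 * s * k + 2 * b * suc k + 96 * s + 0)
    (+-mono-≤ n≤ (+-mono-≤ (*-monoˡ-≤ (suc k) 100s≤n) (+-mono-≤ (*-monoʳ-≤ 4 E≤)
      (+-mono-≤ (*-monoˡ-≤ (12 * s + suc k) w≤3k) 0<s))))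
    (solve 5 (λ n b k w E → let s = b :+ k ; k′ = con 1 :+ k in
      con 1 :+ (con 4 :* E :+ k′ :* (b :+ w) :+ (n :* k′ :+ (con 4 :* (w :* (con 3 :* s))
        :+ (con 3 :* k :* (con 12 :* s :+ k′) :+ s)))) :+
              (con 61 :* s :* k :+ con 2 :* b :* k′ :+ con 96 :* s :+ con 0) :=
      con 0 :+ (n :* k′ :+ (con 100 :* s :* k′ :+ (con 4 :* E :+ (w :* (con 12 :* s :+ k′) :+ con 1)))))
      refl n b k w E)

-- A vertex with few heavy partners in W.

module _ {n : ℕ} (H : ThreeGraph n) where

  -- Double counting of heavy pairs: a vertex of W is not big, so it has at most 3s heavy partners,
  -- whereas without a light vertex every v outside W and B would have more than k / 4 of them in W.
  exists-light-vertex : ∀ {b k} → let s = b + k in 0 < s → 100 * s ≤ n →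
    (W : Subset n) → ∣ W ∣ ≤ 3 * k → Disjoint W (big H (3 * s)) → ∣ big H (3 * s) ∣ ≡ b →
    ∃ λ v → v ∉ W × v ∉ big H (3 * s) × 4 * ∣ W ∩ heavy H (3 * s) v ∣ ≤ k
  exists-light-vertex {b} {k} 0<s 100s≤n W ∣W∣≤3k W∩B=∅ ∣B∣≡b
    with any? (λ v → ¬? (v ∈? W) ×-dec ¬? (v ∈? big H (3 * (b + k))) ×-dec (4 * ∣ W ∩ heavy H (3 * (b + k)) v ∣ ≤? k))
  ... | yes found = found
  ... | no  none  = contradiction total (averaging-impossible {b = b} {k} 0<s 100s≤n ∣W∣≤3k pairs≤)
    where
    s = b + k
    B = big H (3 * s)
    N : Fin n → Subset n
    N = heavy H (3 * s)
    E = sum (λ v → ∣ W ∩ N v ∣)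
    open ≤-Reasoning
    χ-N-sym : ∀ v w → χ (N v) w ≡ χ (N w) v
    χ-N-sym v w with w ∈? N v
    ... | yes w∈ = trans (χ-∈ w∈) (sym (χ-∈ (heavy-sym H w∈)))
    ... | no  w∉ = trans (χ-∉ w∉) (sym (χ-∉ (w∉ ∘ heavy-sym H)))
    few : ∀ w → χ W w * ∣ N w ∣ ≤ χ W w * (3 * s)
    few w with w ∈? W
    ... | no  w∉ = subst (λ z → z * ∣ N w ∣ ≤ z * (3 * s)) (sym (χ-∉ w∉)) z≤n
    ... | yes w∈ = *-monoʳ-≤ (χ W w) (≮⇒≥ (disjoint⁻ W∩B=∅ w∈ ∘ big⁺ H))
    pairs≤ : E ≤ ∣ W ∣ * (3 * s)
    pairs≤ = begin
      E                                              ≡⟨ sum-cong-≗ (λ v → trans (∣p∣≡sum (W ∩ N v))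
            (sum-cong-≗ (λ w → trans (χ-∩ W (N v) w) (cong (χ W w *_) (χ-N-sym v w))))) ⟩
      sum (λ v → sum (λ w → χ W w * χ (N w) v))      ≡⟨ ∑-comm (λ v w → χ W w * χ (N w) v) ⟩
      sum (λ w → sum (λ v → χ W w * χ (N w) v))      ≡⟨ sum-cong-≗ (λ w → trans (sym (*-distribˡ-sum (χ W w)
            (χ (N w)))) (cong (χ W w *_) (sym (∣p∣≡sum (N w))))) ⟩
      sum (λ w → χ W w * ∣ N w ∣)                    ≤⟨ sum-mono few ⟩
      sum (λ w → χ W w * (3 * s))                    ≡⟨ sum-cong-≗ (λ w → *-comm (χ W w) (3 * s)) ⟩
      sum (λ w → 3 * s * χ W w)                      ≡⟨ *-distribˡ-sum (3 * s) (χ W) ⟨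
      3 * s * sum (χ W)                              ≡⟨ cong (3 * s *_) (∣p∣≡sum W) ⟨
      3 * s * ∣ W ∣                                  ≡⟨ *-comm (3 * s) ∣ W ∣ ⟩
      ∣ W ∣ * (3 * s)                                ∎
    -- The second term alone reaches k + 1 when v lies in B or W, so the inequality can be summed
    -- over all vertices.
    many : ∀ v → suc k ≤ 4 * ∣ W ∩ N v ∣ + suc k * (χ B v + χ W v)
    many v with v ∈? W | v ∈? B
    ... | yes v∈W | _       = ≤-trans (≤-trans (m≤m*n (suc k) (χ B v + 1) {{>-nonZero (m≤n+m 1 (χ B v))}})
                                (≤-reflexive (cong (λ z → suc k * (χ B v + z)) (sym (χ-∈ v∈W))))) (m≤n+m _
                                      (4 * ∣ W ∩ N v ∣))
    ... | no  _   | yes v∈B = ≤-trans (≤-trans (m≤m*n (suc k) (1 + χ W v))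
                                (≤-reflexive (cong (λ z → suc k * (z + χ W v)) (sym (χ-∈ v∈B))))) (m≤n+m _
                                      (4 * ∣ W ∩ N v ∣))
    ... | no  v∉W | no v∉B  = ≤-trans (≰⇒> (λ light → none (v , v∉W , v∉B , light))) (m≤m+n _ _)
    total : n * suc k ≤ 4 * E + suc k * (b + ∣ W ∣)
    total = begin
      n * suc k                                      ≡⟨ sum-const n (suc k) ⟨
      sum {n} (λ _ → suc k)                          ≤⟨ sum-mono many ⟩
      sum (λ v → 4 * ∣ W ∩ N v ∣ + suc k * (χ B v + χ W v))
                                                     ≡⟨ ∑-distrib-+ (λ v → 4 * ∣ W ∩ N v ∣) (λ v → suc k *
                                                           (χ B v + χ W v)) ⟩
      sum (λ v → 4 * ∣ W ∩ N v ∣) + sum (λ v → suc k * (χ B v + χ W v))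
                                                     ≡⟨ cong₂ _+_ (*-distribˡ-sum 4 (λ v → ∣ W ∩ N v ∣))
                                                           (*-distribˡ-sum (suc k) (λ v → χ B v + χ W v)) ⟨
      4 * E + suc k * sum (λ v → χ B v + χ W v)      ≡⟨ cong (λ z → 4 * E + suc k * z) (trans (∑-distrib-+
            (χ B) (χ W)) (cong₂ _+_ (trans (sym (∣p∣≡sum B)) ∣B∣≡b) (sym (∣p∣≡sum W)))) ⟩
      4 * E + suc k * (b + ∣ W ∣)                    ∎

-- Weights with three values and their row sums.

module _ {n : ℕ} (C W : Subset n) (κ μ β : ℕ) where

  -- C takes precedence because it may overlap W.
  weight : Fin n → ℕ
  weight y = if lookup C y then κ else if lookup W y then μ else β

  weight-C : ∀ {y} → y ∈ C → weight y ≡ κ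
  weight-C y∈C rewrite []=⇒lookup y∈C = refl

  weight-pos : 0 < κ → 0 < μ → 0 < β → ∀ y → 0 < weight y
  weight-pos 0<κ 0<μ 0<β y with lookup C y | lookup W y
  ... | true  | _     = 0<κ
  ... | false | true  = 0<μ
  ... | false | false = 0<β

  -- All of C is charged as if adjacent. S accounts for the neighbours outside C: it is the
  -- neighbourhood itself for a row in W, and W for a row outside C and W.
  weight-via : (e : Fin n → ℕ) (S : Subset n) → (∀ y → e y ≤ 1) →
    (∀ y → y ∉ C → e y * weight y ≤ μ * χ S y) →
    sum (λ y → e y * weight y) ≤ ∣ C ∣ * κ + ∣ S ∣ * μ
  weight-via e S e≤1 off-C = begin
    sum (λ y → e y * weight y)                 ≤⟨ sum-mono pointwise ⟩
    sum (λ y → κ * χ C y + μ * χ S y)          ≡⟨ ∑-distrib-+ (λ y → κ * χ C y) (λ y → μ * χ S y) ⟩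
    sum (λ y → κ * χ C y) + sum (λ y → μ * χ S y) ≡⟨ cong₂ _+_ (total κ C) (total μ S) ⟩
    ∣ C ∣ * κ + ∣ S ∣ * μ                      ∎
    where
    open ≤-Reasoning
    total : ∀ c (p : Subset n) → sum (λ y → c * χ p y) ≡ ∣ p ∣ * c
    total c p = trans (sym (*-distribˡ-sum c (χ p))) (trans (cong (c *_) (sym (∣p∣≡sum p))) (*-comm c ∣ p ∣))
    pointwise : ∀ y → e y * weight y ≤ κ * χ C y + μ * χ S y
    pointwise y with y ∈? C
    ... | no  y∉C = ≤-trans (off-C y y∉C) (m≤n+m (μ * χ S y) (κ * χ C y))
    ... | yes y∈C = ≤-trans (*-mono-≤ (e≤1 y) (≤-reflexive (weight-C y∈C)))
      (≤-trans (≤-reflexive (trans (*-comm 1 κ) (cong (κ *_) (sym (χ-∈ y∈C))))) (m≤m+n (κ * χ C y) (μ * χ S y)))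

  weight-W : ∀ {y} → y ∉ C → y ∈ W → weight y ≡ μ
  weight-W {y} y∉C y∈W rewrite []=⇒lookup y∈W with lookup C y in eq
  ... | true  = contradiction (lookup⇒[]= y C eq) y∉C
  ... | false = refl

  weight-rest : ∀ {y} → y ∉ C → y ∉ W → weight y ≡ β
  weight-rest {y} y∉C y∉W with lookup C y in eqC | lookup W y in eqW
  ... | true  | _     = contradiction (lookup⇒[]= y C eqC) y∉C
  ... | false | true  = contradiction (lookup⇒[]= y W eqW) y∉W
  ... | false | false = refl

  weight≤μ : β ≤ μ → ∀ y → y ∉ C → weight y ≤ μ
  weight≤μ β≤μ y y∉C with y ∈? W
  ... | yes y∈W = ≤-reflexive (weight-W y∉C y∈W)
  ... | no  y∉W = ≤-trans (≤-reflexive (weight-rest y∉C y∉W)) β≤μ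

  -- The right side lets every vertex be a neighbour of x and charges β everywhere, on top of κ on C
  -- and μ on W. The terms added on the left are overcounts: κ at x, which is not its own neighbour,
  -- β on B, already paid for by κ, and β at v.
  weight-core : (e : Fin n → ℕ) → (∀ y → e y ≤ 1) → ∀ {B x v} → B ⊆ C → x ∈ C → v ∉ C → e x ≡ 0 → e v ≡ 0 →
    sum (λ y → e y * weight y) + κ + ∣ B ∣ * β + β ≤ ∣ C ∣ * κ + ∣ W ∣ * μ + n * β
  weight-core e e≤1 {B} {x} {v} B⊆C x∈C v∉C ex≡0 ev≡0 = begin
    S + κ + ∣ B ∣ * β + β                      ≡⟨ cong₂ _+_ (cong₂ _+_ (cong (S +_) (singleton κ x))
          (total β B)) (singleton β v) ⟩
    S + sum (κ∙ ⁅ x ⁆) + sum (β∙ B) + sum (β∙ ⁅ v ⁆)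
      ≡⟨ cong (_+ sum (β∙ ⁅ v ⁆)) (trans (∑-distrib-+ (λ y → f y + κ∙ ⁅ x ⁆ y) (β∙ B)) (cong (_+ sum (β∙ B))
            (∑-distrib-+ f (κ∙ ⁅ x ⁆)))) ⟨
    sum (λ y → f y + κ∙ ⁅ x ⁆ y + β∙ B y) + sum (β∙ ⁅ v ⁆)
      ≡⟨ ∑-distrib-+ (λ y → f y + κ∙ ⁅ x ⁆ y + β∙ B y) (β∙ ⁅ v ⁆) ⟨
    sum (λ y → f y + κ∙ ⁅ x ⁆ y + β∙ B y + β∙ ⁅ v ⁆ y) ≤⟨ sum-mono pointwise ⟩
    sum (λ y → κ∙ C y + μ∙ W y + β)            ≡⟨ trans (∑-distrib-+ (λ y → κ∙ C y + μ∙ W y) (λ _ → β)) (cong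
          (_+ sum {n} (λ _ → β)) (∑-distrib-+ (κ∙ C) (μ∙ W))) ⟩
    sum (κ∙ C) + sum (μ∙ W) + sum {n} (λ _ → β) ≡⟨ cong₂ _+_ (cong₂ _+_ (total κ C) (total μ W)) (sym
          (sum-const n β)) ⟨
    ∣ C ∣ * κ + ∣ W ∣ * μ + n * β              ∎
    where
    open ≤-Reasoning
    f : Fin n → ℕ
    f y = e y * weight y
    S = sum f
    κ∙ μ∙ β∙ : Subset n → Fin n → ℕ
    κ∙ p y = κ * χ p y
    μ∙ p y = μ * χ p y
    β∙ p y = β * χ p y
    total : ∀ c (p : Subset n) → ∣ p ∣ * c ≡ sum (λ y → c * χ p y)
    total c p = trans (*-comm ∣ p ∣ c) (trans (cong (c *_) (∣p∣≡sum p)) (*-distribˡ-sum c (χ p)))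
    singleton : ∀ c z → c ≡ sum (λ y → c * χ ⁅ z ⁆ y)
    singleton c z = trans (sym (trans (cong (_* c) (∣⁅x⁆∣≡1 z)) (*-identityˡ c))) (total c ⁅ z ⁆)
    χ-≢ : ∀ {y z} → y ≢ z → χ ⁅ z ⁆ y ≡ 0
    χ-≢ {y} {z} y≢z = χ-∉ (y≢z ∘ x∈⁅y⁆⇒x≡y z)
    χ≤1 : ∀ (p : Subset n) y → χ p y ≤ 1
    χ≤1 p y = ind≤1 (lookup p y)
    c*≤ : ∀ c {z} → z ≤ 1 → c * z ≤ c
    c*≤ c z≤1 = ≤-trans (*-monoʳ-≤ c z≤1) (≤-reflexive (*-identityʳ c))
    on-C : ∀ y → y ∈ C → f y + κ * χ ⁅ x ⁆ y ≤ κ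
    on-C y y∈C with y Fin.≟ x
    ... | yes refl rewrite ex≡0 = c*≤ κ (χ≤1 ⁅ y ⁆ y)
    ... | no  y≢x  rewrite χ-≢ y≢x | *-zeroʳ κ | +-identityʳ (f y) | weight-C y∈C =
      ≤-trans (*-monoˡ-≤ κ (e≤1 y)) (≤-reflexive (*-identityˡ κ))
    off-C : ∀ y → y ∉ C → f y + β * χ ⁅ v ⁆ y ≤ μ * χ W y + β
    off-C y y∉C with y Fin.≟ v
    ... | yes refl rewrite ev≡0 = ≤-trans (c*≤ β (χ≤1 ⁅ y ⁆ y)) (m≤n+m β _)
    ... | no  y≢v  rewrite χ-≢ y≢v | *-zeroʳ β | +-identityʳ (f y) = outside-C
      where
      outside-C : f y ≤ μ * χ W y + β
      outside-C with y ∈? W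
      ... | yes y∈W rewrite χ-∈ y∈W | weight-W y∉C y∈W | *-identityʳ μ =
        ≤-trans (≤-trans (*-monoˡ-≤ μ (e≤1 y)) (≤-reflexive (*-identityˡ μ))) (m≤m+n μ β)
      ... | no  y∉W rewrite weight-rest y∉C y∉W =
        ≤-trans (≤-trans (*-monoˡ-≤ β (e≤1 y)) (≤-reflexive (*-identityˡ β))) (m≤n+m β _)
    pointwise : ∀ y → f y + κ * χ ⁅ x ⁆ y + β * χ B y + β * χ ⁅ v ⁆ y ≤ κ * χ C y + μ * χ W y + β
    pointwise y with y ∈? C
    ... | yes y∈C rewrite χ-∈ y∈C | χ-≢ {y} {v} (λ { refl → v∉C y∈C }) | *-identityʳ κ | *-zeroʳ β
                        | +-identityʳ (f y + κ * χ ⁅ x ⁆ y + β * χ B y) =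
      +-mono-≤ (≤-trans (on-C y y∈C) (m≤m+n κ (μ * χ W y))) (c*≤ β (χ≤1 B y))
    ... | no  y∉C rewrite χ-∉ y∉C | χ-≢ {y} {x} (λ { refl → y∉C x∈C }) | χ-∉ (y∉C ∘ B⊆C) | *-zeroʳ κ | *-zeroʳ β
                        | +-identityʳ (f y) | +-identityʳ (f y) = off-C y y∉C

-- The weights as a supersolution on the link of a light vertex.

module _ {n : ℕ} (H : ThreeGraph (suc n)) where

  adj-link : ∀ v i j → adj (link H v) i j ≡ χ (neighbours H v (punchIn v i)) (punchIn v j)
  adj-link v i j = trans (cong (ind ∘ edge? H) (insertAt-pair v i j))
    (cong ind (sym (lookup∘tabulate (λ z → edge? H (triple v (punchIn v i) z)) (punchIn v j))))

  module _ (b k m a p : ℕ) (0<s : 0 < b + k) (0<p : 0 < p) (98s≤m : 98 * (b + k) ≤ m)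
    (quadratic : (b + k) * (a * p) + (b + k) * m * (p * p) ≤ a * a + a * p) (n≡ : suc n ≡ 1 + (b + k) + m)
    (W : Subset (suc n)) (∣W∣≤3k : ∣ W ∣ ≤ 3 * k) (∣B∣≡b : ∣ big H (3 * (b + k)) ∣ ≡ b)
    (cover : ∀ e → IsEdge H e → ¬ Disjoint e (W ∪ big H (3 * (b + k))))
    (v : Fin (suc n)) (v∉W : v ∉ W) (v∉B : v ∉ big H (3 * (b + k)))
    (light : 4 * ∣ W ∩ heavy H (3 * (b + k)) v ∣ ≤ k) where

    open Numeric b k m a p 0<s 0<p 98s≤m quadratic

    private
      s = b + k
      B = big H (3 * s)
      C = B ∪ (W ∩ heavy H (3 * s) v)
      -- The weights 4q, 6s and 4b + 3k are multiplied by p to stay within ℕ.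
      κ = 4 * a
      μ = 6 * (s * p)
      β = (4 * b + 3 * k) * p
      N = neighbours H v
      ω = weight C W κ μ β

      0<sp : 0 < s * p
      0<sp = *-mono-≤ 0<s 0<p

      v∉C : v ∉ C
      v∉C v∈C with x∈p∪q⁻ B _ v∈C
      ... | inj₁ v∈B  = v∉B v∈B
      ... | inj₂ v∈WN = v∉W (proj₁ (x∈p∩q⁻ W _ v∈WN))

      4∣C∣≤ : 4 * ∣ C ∣ ≤ 4 * b + k
      4∣C∣≤ = begin
        4 * ∣ C ∣                                     ≤⟨ *-monoʳ-≤ 4 (∣p∪q∣≤∣p∣+∣q∣ B (W ∩ heavy H (3 * s) v)) ⟩
        4 * (∣ B ∣ + ∣ W ∩ heavy H (3 * s) v ∣)       ≡⟨ *-distribˡ-+ 4 ∣ B ∣ _ ⟩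
        4 * ∣ B ∣ + 4 * ∣ W ∩ heavy H (3 * s) v ∣     ≤⟨ +-mono-≤ (≤-reflexive (cong (4 *_) ∣B∣≡b)) light ⟩
        4 * b + k                                     ∎
        where open ≤-Reasoning

      χ≤1 : ∀ x y → χ (N x) y ≤ 1
      χ≤1 x y = ind≤1 (lookup (N x) y)

      β≤μ : β ≤ μ
      β≤μ = by-certificate (2 * b * p + 3 * k * p) (z≤n {0})
        (solve 3 (λ b k p → (con 4 :* b :+ con 3 :* k) :* p :+ con 0 :+ (con 2 :* b :* p :+ con 3 :* k :* p) :=
          con 6 :* ((b :+ k) :* p) :+ con 0) refl b k p)

      0<β : 0 < β
      0<β = *-mono-≤ (≤-trans 0<s (+-mono-≤ (m≤n*m b 4) (m≤n*m k 3))) 0<p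

      no-edge : ∀ {x y} → ¬ IsEdge H (triple v x y) → y ∉ N x
      no-edge ¬e = ¬e ∘ neighbours⁻ H

      R : Fin (suc n) → ℕ
      R x = sum (λ y → χ (N x) y * ω y)

      row : ∀ x → x ≢ v → p * R x ≤ a * ω x
      row x x≢v with x ∈? C
      ... | yes x∈C = subst (λ z → p * R x ≤ a * z) (sym (weight-C C W κ μ β x∈C))
        (row-core {∣ C ∣} 4∣C∣≤ {∣ W ∣} ∣W∣≤3k {R x} (subst₂
              (λ z t → R x + κ + z * β + β ≤ ∣ C ∣ * κ + ∣ W ∣ * μ + t * β) ∣B∣≡b n≡
          (weight-core C W κ μ β (χ (N x)) (χ≤1 x) (p⊆p∪q _) x∈C v∉C
            -- A triple with a repeated vertex is no edge, so neither x nor v is a neighbour of x in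
            -- the link.
            (χ-∉ (no-edge λ e → triple-distinct H (subst (IsEdge H) (trans (triple-swap₁₂ v x x)
                  (triple-swap₂₃ x v x)) e) refl))
            (χ-∉ (no-edge λ e → triple-distinct H (subst (IsEdge H) (triple-swap₂₃ v x v) e) refl)))))
      ... | no x∉C with x ∈? W
      -- A vertex of W outside C is no heavy partner of v, so its degree in the link is at most 3s.
      ...   | yes x∈W = subst (λ z → p * R x ≤ a * z) (sym (weight-W C W κ μ β x∉C x∈W))
        (row-light {∣ C ∣} 4∣C∣≤ {R x} {∣ N x ∣} (≮⇒≥ λ h → x∉C (x∈p∪q⁺ (inj₂ (x∈p∩q⁺ (x∈W , heavy⁺ H h)))))
          (weight-via C W κ μ β (χ (N x)) (N x) (χ≤1 x)
            (λ y y∉C → ≤-trans (*-monoʳ-≤ (χ (N x) y) (weight≤μ C W κ μ β β≤μ y y∉C)) (≤-reflexive (*-comm (χ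
                  (N x) y) μ)))))
      ...   | no x∉W = subst (λ z → p * R x ≤ a * z) (sym (weight-rest C W κ μ β x∉C x∉W))
        (row-outside {∣ C ∣} 4∣C∣≤ {∣ W ∣} ∣W∣≤3k {R x} (weight-via C W κ μ β (χ (N x)) W (χ≤1 x) into-W))
        where
        into-W : ∀ y → y ∉ C → χ (N x) y * ω y ≤ μ * χ W y
        into-W y y∉C with y ∈? W
        ... | yes y∈W rewrite χ-∈ y∈W | *-identityʳ μ =
          ≤-trans (*-mono-≤ (χ≤1 x y) (≤-reflexive (weight-W C W κ μ β y∉C y∈W))) (≤-reflexive (*-identityˡ μ))
        -- An edge v x y with x and y outside C and W would miss the cover W ∪ B.
        ... | no  y∉W = ≤-trans (≤-reflexive (cong (_* ω y) (χ-∉ (no-edge λ e → cover _ e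
              (disjoint⁺ λ u∈ → uncovered (triple-∈⁻ u∈)))))) z≤n
          where
          off : ∀ {z} → z ∉ W → z ∉ B → z ∉ W ∪ B
          off z∉W z∉B z∈ with x∈p∪q⁻ W B z∈
          ... | inj₁ z∈W = z∉W z∈W
          ... | inj₂ z∈B = z∉B z∈B
          uncovered : ∀ {u} → u ≡ v ⊎ u ≡ x ⊎ u ≡ y → u ∉ W ∪ B
          uncovered (inj₁ refl)        = off v∉W v∉B
          uncovered (inj₂ (inj₁ refl)) = off x∉W (x∉C ∘ p⊆p∪q _)
          uncovered (inj₂ (inj₂ refl)) = off y∉W (y∉C ∘ p⊆p∪q _)

    -- Passing to the complement of v drops a nonnegative term from each row sum. Positivity on C
    -- comes from a ≥ 9 s p > 0.
    link-supersolution : ∃ λ (w : Fin n → ℕ) → (∀ i → 0 < w i) ×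
      (∀ i → p * sum (λ j → adj (link H v) i j * w j) ≤ a * w i)
    link-supersolution = ω ∘ punchIn v ,
      (λ i → weight-pos C W κ μ β (*-mono-≤ {1} {4} (s≤s z≤n) (≤-trans (*-mono-≤ {1} {9}
            (s≤s z≤n) 0<sp) 9sp≤a)) (*-mono-≤ {1} {6} (s≤s z≤n) 0<sp) 0<β (punchIn v i)) ,
      λ i → ≤-trans (*-monoʳ-≤ p (≤-trans (≤-reflexive (sum-cong-≗ (λ j → cong (_* ω (punchIn v j))
            (adj-link v i j))))
                (sum-punchIn v (λ y → χ (N (punchIn v i)) y * ω y))))
              (row (punchIn v i) (punchInᵢ≢i v i))

-- The choice of q, the contradiction and the final case distinction.

exceeds-threshold : ∀ s m ρ → 0 < s →
  fromℚ ½ *ℝ (fromℕ (s ∸ 1) +ℝ √ ((s ∸ 1) ^ 2 + 4 * s * m)) <ℝ ρ →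
  ∃ λ a → ∃ λ p → 0 < p × s * (a * p) + s * m * (p * p) ≤ a * a + a * p ×
  ∃ λ N → ∀ i → N ≤ i → ι a ℚ.+ ℚ.1ℚ ℚ.≤ ι p ℚ.* seq ρ i
exceeds-threshold (suc t) m ρ _ λ<ρ =
  let j , r , D<R² , N , large = rational-threshold t (t ^ 2 + 4 * suc t * m) ρ λ<ρ
  -- This is a / p = (t + (r + 1) / (j + 1)) / 2, where (r + 1) / (j + 1) exceeds the square root in
  -- the threshold.
  in t * suc j + suc r , 2 * suc j , s≤s z≤n , quadratic-from-root t m (suc j) (suc r) D<R² , N , large

-- When B and the vertices of M cover all edges, one light vertex v refutes the spectral hypothesis:
-- the weights on its link leave no room for an eigenvalue above q.
no-small-cover : ∀ {n b k s} → b + k ≡ s → 0 < s → suc n ≥ 100 * s → (H : ThreeGraph (suc n)) →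
  ∣ big H (3 * s) ∣ ≡ b → ∀ {M} → MaximalAvoiding H M (big H (3 * s)) → length M ≤ k →
  ¬ (∀ v → ∃ λ ρ → IsSpectralRadius (link H v) ρ ×
    fromℚ ½ *ℝ (fromℕ (s ∸ 1) +ℝ √ ((s ∸ 1) ^ 2 + 4 * s * (suc n ∸ s ∸ 1))) <ℝ ρ)
no-small-cover {n} {b} {k} refl 0<s 100s≤n H ∣B∣≡b {M} (M-match , M-d , maximal) len≤k ρ-large =
  let s = b + k
      m = suc n ∸ s ∸ 1
      ∣W∣≤3k = ≤-trans (∣⋃∣≤ H M-match) (*-monoʳ-≤ 3 len≤k)
      v , v∉W , v∉B , light = exists-light-vertex H {b} {k} 0<s 100s≤n (⋃ M) ∣W∣≤3k M-d ∣B∣≡b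
      ρ , (ρ-eigenvalue , _) , λ<ρ = ρ-large v
      a , p , 0<p , quadratic , N , large = exceeds-threshold s m ρ 0<s λ<ρ
      ω , 0<ω , super = link-supersolution H b k m a p 0<s 0<p (98s≤m s 0<s 100s≤n) quadratic
                          (n≡1+s+m s 0<s 100s≤n) (⋃ M) ∣W∣≤3k ∣B∣≡b maximal v v∉W v∉B light
  in eigenvalue-bound (link H v) ρ ρ-eigenvalue ω 0<ω a p super N large
  where
  -- The truncated subtractions in the threshold are exact, because s + 1 ≤ 100 s.
  n≡1+s+m : ∀ s → 0 < s → 100 * s ≤ suc n → suc n ≡ 1 + s + (suc n ∸ s ∸ 1)
  n≡1+s+m s 0<s 100s≤n = begin
    suc n                            ≡⟨ m+[n∸m]≡n {s + 1} {suc n} (≤-trans (by-certificate 98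
          (*-monoʳ-≤ 99 0<s) (solve 1 (λ s →
                                          s :+ con 1 :+ con 99 :* s :+ con 98 := con 100 :* s :+ con 99 :* con 1) refl s)) 100s≤n) ⟨
    s + 1 + (suc n ∸ (s + 1))        ≡⟨ cong₂ _+_ (+-comm s 1) (sym (∸-+-assoc (suc n) s 1)) ⟩
    1 + s + (suc n ∸ s ∸ 1)          ∎
    where open ≡-Reasoning
  98s≤m : ∀ s → 0 < s → 100 * s ≤ suc n → 98 * s ≤ suc n ∸ s ∸ 1
  98s≤m s 0<s 100s≤n = by-certificate 0
    (+-mono-≤ (≤-trans 100s≤n (≤-reflexive (n≡1+s+m s 0<s 100s≤n))) 0<s)
    (solve 2 (λ s m → con 98 :* s :+ (con 1 :+ s :+ m :+ s) :+ con 0 := m :+ (con 100 :* s :+ con 1)) refl s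
          (suc n ∸ s ∸ 1))

theorem1p3 : (n s : ℕ) → 0 < n → 0 < s → n ≥ 100 * s →
    (H : ThreeGraph n) →
    (∀ v → ∃ λ ρ → IsSpectralRadius (link H v) ρ ×
      fromℚ ½ *ℝ (fromℕ (s ∸ 1) +ℝ √ ((s ∸ 1) ^ 2 + 4 * s * (n ∸ s ∸ 1))) <ℝ ρ) →
    ∃ λ M → IsMatching H M × length M ≡ suc s
theorem1p3 (suc n) s _ 0<s n≥100s H ρ-large =
  let M , M-match , len , _ = matching (suc s ≤? ∣ B ∣) in M , M-match , len
  where
  B = big H (3 * s)
  matching : Dec (suc s ≤ ∣ B ∣) → MatchingAvoiding H (suc s) Subset.⊥
  -- More than s big vertices: s + 1 of them are absorbed, starting from the empty matching.
  matching (yes s<∣B∣) =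
    let Y , Y⊆B , ∣Y∣ = sub-of-size B s<∣B∣
    in absorb H s (suc s) 0 Y ∣Y∣ Y⊆B ([] , ([] , []) , refl , disjoint⁺ (λ x∈⊥ → contradiction x∈⊥ ∉⊥)) refl
  matching (no ∣B∣≤s) = either (greedy H (suc k) B)
    where
    k = s ∸ ∣ B ∣
    b+k≡s : ∣ B ∣ + k ≡ s
    b+k≡s = m+[n∸m]≡n (≮⇒≥ ∣B∣≤s)
    either : MatchingAvoiding H (suc k) B ⊎ (∃ λ M → length M < suc k × MaximalAvoiding H M B) →
      MatchingAvoiding H (suc s) Subset.⊥
    -- The k + 1 edges avoiding B and one edge for each of the s - k big vertices make s + 1.
    either (inj₁ found) = absorb H s ∣ B ∣ (suc k) B refl id found (cong suc (trans (+-comm k ∣ B ∣) b+k≡s))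
    either (inj₂ (M , s≤s len≤k , maximal)) =
      contradiction ρ-large (no-small-cover b+k≡s 0<s n≥100s H refl maximal len≤k)
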